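{- Let $m\ge1$ and $p\ge0$ be integers and $r\in\{0,1\}$. Define \[F(m,p):=\mathfrak{S}_{1^m\times w_0(p)}(1,1,\ldots,1),\qquad \tilde F(2m,2p+r):=\left|\mathfrak{S}_{1^{2m}\times\tilde w_0(2p+r)}(1,-1,1,-1,\ldots)\right|.\] Then \[\tilde F(2m,2p+r)=\begin{cases}F(m,p)^2 & \text{if } r=0,\\ F(m,p)\,F(m,p+1) & \text{if } r=1.\end{cases}\]
   Context: $\mathfrak{S}_w$ is the Schubert polynomial of $w$. For $u\in S_a$, $v\in S_b$, $u\times v:=(u_1,\ldots,u_a,v_1+a,\ldots,v_b+a)\in S_{a+b}$, and $1^a$ is the identity in $S_a$, so $1^a\times v=(1,\ldots,a,v_1+a,\ldots,v_b+a)$. $w_0(p)=(p,p-1,\ldots,1)\in S_p$. For $N\ge 1$, $\tilde w_0(N):=(N-1,N,N-3,N-2,\ldots)\in S_N$, i.e. $(N-1,N,N-3,N-2,\ldots,1,2)$ if $N$ is even and $(N-1,N,N-3,N-2,\ldots,2,3,1)$ if $N$ is odd; $\tilde w_0(0)$ and $w_0(0)$ are the empty permutation. -}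

module Defs where

open import Data.Nat using (ℕ; zero; suc; _∸_; _<ᵇ_) renaming (_+_ to _+ℕ_; _*_ to _*ℕ_)
open import Data.Integer using (ℤ; +_; -_; ∣_∣) renaming (_+_ to _+ℤ_; _*_ to _*ℤ_)
open import Data.List using (List; []; _∷_; _++_; map; concatMap; length)
open import Data.Maybe using (Maybe; just; nothing)
open import Data.Product using (_×_; _,_)
open import Data.Bool using (if_then_else_)

-- Permutations in one-line notation (values 1..n), as lists of ℕ.

Perm : Set
Perm = List ℕ

idPerm : ℕ → Perm
idPerm a = go 1 a
  where
  go : ℕ → ℕ → Perm
  go k zero = []
  go k (suc n) = k ∷ go (suc k) n

idTimes : ℕ → Perm → Perm
idTimes a v = idPerm a ++ map (λ x → x +ℕ a) v

w0 : ℕ → Perm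
w0 zero = []
w0 (suc p) = suc p ∷ w0 p

w̃0 : ℕ → Perm
w̃0 zero = []
w̃0 (suc zero) = 1 ∷ []
w̃0 (suc (suc N)) = suc N ∷ suc (suc N) ∷ w̃0 N

-- swap positions i, i+1 (0-based), i.e. w ↦ w s_{i+1}
swapAt : ℕ → Perm → Perm
swapAt zero (x ∷ y ∷ r) = y ∷ x ∷ r
swapAt (suc i) (x ∷ r) = x ∷ swapAt i r
swapAt _ w = w

firstAscent : Perm → Maybe ℕ
firstAscent (x ∷ y ∷ r) = if x <ᵇ y then just zero else Data.Maybe.map suc (firstAscent (y ∷ r))
firstAscent _ = nothing

-- Polynomials in x_1, x_2, ... over ℤ: formal sums of terms c · x^e,
-- where the exponent list e = (e_0, e_1, ...) means x_1^{e_0} x_2^{e_1} ⋯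
-- (missing trailing entries are 0).

Poly : Set
Poly = List (ℤ × List ℕ)

get : List ℕ → ℕ → ℕ
get [] _ = 0
get (x ∷ _) zero = x
get (_ ∷ xs) (suc i) = get xs i

set : List ℕ → ℕ → ℕ → List ℕ
set [] zero v = v ∷ []
set [] (suc i) v = 0 ∷ set [] i v
set (_ ∷ xs) zero v = v ∷ xs
set (x ∷ xs) (suc i) v = x ∷ set xs i v

stepsDown : ℕ → ℕ → ℕ → List (ℕ × ℕ)
stepsDown zero x y = []
stepsDown (suc n) x y = (x , y) ∷ stepsDown n (x ∸ 1) (suc y)

stepsUp : ℕ → ℕ → ℕ → List (ℕ × ℕ)
stepsUp zero x y = []
stepsUp (suc n) x y = (x , y) ∷ stepsUp n (suc x) (y ∸ 1)

-- Divided difference ∂ = (f - s f)/(x_{i+1} - x_{i+2}) (0-based i) on a term.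
-- With a = exponent of x_{i+1}, b = exponent of x_{i+2}:
--   a > b : ∂(x^a y^b) =  Σ_{k=0}^{a-b-1} x^{a-1-k} y^{b+k}
--   a < b : ∂(x^a y^b) = -Σ_{k=0}^{b-a-1} x^{a+k} y^{b-1-k}
--   a = b : 0
ddTerm : ℕ → ℤ × List ℕ → Poly
ddTerm i (c , e) =
  if b <ᵇ a
  then map (λ { (α , β) → c , set (set e i α) (suc i) β }) (stepsDown (a ∸ b) (a ∸ 1) b)
  else (if a <ᵇ b
        then map (λ { (α , β) → - c , set (set e i α) (suc i) β }) (stepsUp (b ∸ a) a (b ∸ 1))
        else [])
  where
  a = get e i
  b = get e (suc i)

dd : ℕ → Poly → Poly
dd i = concatMap (ddTerm i)

stair : ℕ → List ℕ
stair zero = []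
stair (suc n) = n ∷ stair n

-- Schubert polynomials (Lascoux–Schützenberger): for w ∈ S_n,
--   𝔖_{w_0} = x_1^{n-1} x_2^{n-2} ⋯ x_{n-1},
--   𝔖_w = ∂_i 𝔖_{w s_i} whenever w(i) < w(i+1).
-- The recursion uses the first ascent; fuel n*n always suffices since each
-- step increases the length by one (at most n(n-1)/2 steps).
schubertAux : ℕ → Perm → Poly
schubertAux fuel w with firstAscent w
... | nothing = (+ 1 , stair (length w)) ∷ []
... | just i with fuel
...   | zero = []
...   | suc f = dd i (schubertAux f (swapAt i w))

schubert : Perm → Poly
schubert w = schubertAux (length w *ℕ length w) w

-- Evaluation at a point x : ℕ → ℤ (x j is the value of x_{j+1}).

pow : ℤ → ℕ → ℤ
pow z zero = + 1
pow z (suc n) = z *ℤ pow z n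

evalMono : (ℕ → ℤ) → List ℕ → ℤ
evalMono x [] = + 1
evalMono x (e ∷ es) = pow (x zero) e *ℤ evalMono (λ j → x (suc j)) es

eval : (ℕ → ℤ) → Poly → ℤ
eval x [] = + 0
eval x ((c , e) ∷ ts) = c *ℤ evalMono x e +ℤ eval x ts

ones : ℕ → ℤ
ones _ = + 1

alt : ℕ → ℤ
alt zero = + 1
alt (suc zero) = - (+ 1)
alt (suc (suc j)) = alt j

F : ℕ → ℕ → ℤ
F m p = eval ones (schubert (idTimes m (w0 p)))

F̃ : ℕ → ℕ → ℤ
F̃ a N = + ∣ eval alt (schubert (idTimes a (w̃0 N))) ∣

{-# OPTIONS --safe #-}
module Submission where

-- `schubertAux` always follows the first ascent, so its chain from 1ᵃ × v begins by reversing the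
-- identity block; this is why w_0(a) × v has to be computed first. The determinants are symmetric
-- in x_0, ..., x_{a-1}, so undoing that reversal only strips x^{stair(a)}, and 𝔖 of 1ᵃ × v is the
-- bare determinant. The formal sums of `Poly` have no canonical form, so everything is compared by
-- evaluation. A divided difference is then known only after multiplication by x_i - x_{i+1}, which
-- may be 0 at the point in question; in particular it is 0 at (1, 1, ...). Cancelling that factor
-- is the purpose of `Congruent`. In `flagged D n` the first column D and the size n are separate
-- parameters, because 𝔖 for w_0(p + 1) is needed in two shapes: size p + 1 and size p, both with
-- first column p + 1. For odd N the columns of one parity start one later than those of the other,
-- and the second shape appears.

-- Up to the factor x^{stair(a)}, the Schubert polynomials of w_0(a) × w_0(p) and w_0(a) × w̃_0(N) are flagged determinants
-- with entries h_{d−k}(x_0, …, x_{f−1}). Inserting a new maximum borders the determinant by the row of powers of x_0, and the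
-- isobaric divided differences that move the maximum past w_0(a) only raise the flag of that one row.
-- For w̃_0 the rows come in pairs (k, f), (k + 1, f + 1), and a row operation makes both flags even. At (1, −1, 1, −1, …)
-- the series 1 / ∏ (1 − x_i t) is then a power of 1 / (1 − t²), so the determinant splits by parity into two determinants,
-- each of which is F(m, p) or F(m, p + 1). The absolute value is removed because these are nonnegative.

open import Defs
open import Data.Nat using (ℕ; suc; _≤_) renaming (_+_ to _+ℕ_; _*_ to _*ℕ_)
open import Data.Integer using () renaming (_*_ to _*ℤ_)
open import Data.Product using (_×_)
open import Relation.Binary.PropositionalEquality using (_≡_)

open import Data.Nat using (zero; _<_; _<ᵇ_; _∸_; z≤n; s≤s)
import Data.Nat.Properties as ℕₚ
open import Data.Integer using (ℤ; +_; -_; _+_; _*_; _-_; ∣_∣; 0ℤ; 1ℤ; +≤+) renaming (_≤_ to _≤ℤ_)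
import Data.Integer.Properties as ℤₚ
open import Data.Integer.Tactic.RingSolver using (solve-∀)
open import Data.Bool using (true; false; T; if_then_else_)
open import Data.Empty using (⊥-elim)
open import Data.List using (List; []; _∷_; _++_; map; length; applyUpTo; upTo)
open import Data.List.Properties using (++-assoc; ++-identityʳ; length-++; length-map; map-applyUpTo; map-upTo; length-applyUpTo)
open import Data.List.Relation.Binary.Permutation.Propositional using (_↭_; ↭-refl; ↭-trans; ↭-sym; ↭-reflexive; prep; swap) renaming (refl to ↭-refl′; trans to ↭-trans′)
open import Data.List.Relation.Binary.Permutation.Propositional.Properties using (shift; ++-comm)
open import Data.List.Relation.Unary.All as All using (All; []; _∷_)
open import Data.List.Relation.Unary.All.Properties using (++⁺; ++⁻ˡ; map⁺; applyUpTo⁺₂)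
open import Data.List.Relation.Unary.Linked as Linked using (Linked; []; [-]; _∷_)
import Data.List.Relation.Unary.Linked.Properties as Linkedₚ
open import Data.Maybe using (just; nothing)
open import Data.Product using (_,_; proj₁; proj₂)
open import Data.Sum using (_⊎_; inj₁; inj₂)
open import Data.Unit using (⊤; tt)
open import Relation.Binary.Definitions using (tri<; tri≈; tri>)
open import Relation.Binary.PropositionalEquality using (_≢_; refl; sym; trans; cong; cong₂; subst; module ≡-Reasoning)
open import Relation.Nullary using (yes; no)
open ≡-Reasoning

-- Divided differences of polynomial functions

Point : Set
Point = ℕ → ℤ

tail : Point → Point
tail x i = x (suc i)

transpose : ℕ → Point → Point
transpose zero x zero = x 1
transpose zero x (suc zero) = x 0
transpose zero x (suc (suc j)) = x (suc (suc j))
transpose (suc i) x zero = x 0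
transpose (suc i) x (suc j) = transpose i (tail x) j

infix 4 _≈_[mod_]

record _≈_[mod_] (a b t : ℤ) : Set where
  constructor quotient
  field
    multiple : ℤ
    equality : a ≡ b + multiple * t

≈-reflexive : ∀ {t a b} → a ≡ b → a ≈ b [mod t ]
≈-reflexive {t} {a} refl = quotient 0ℤ (identity t a)
  where
  identity : ∀ t a → a ≡ a + 0ℤ * t
  identity = solve-∀

≈-+ : ∀ {t a b c d} → a ≈ b [mod t ] → c ≈ d [mod t ] → a + c ≈ b + d [mod t ]
≈-+ {t} {_} {b} {_} {d} (quotient q refl) (quotient r refl) = quotient (q + r) (identity t b d q r)
  where
  identity : ∀ t b d q r → (b + q * t) + (d + r * t) ≡ (b + d) + (q + r) * t
  identity = solve-∀

≈-* : ∀ {t a b c d} → a ≈ b [mod t ] → c ≈ d [mod t ] → a * c ≈ b * d [mod t ]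
≈-* {t} {_} {b} {_} {d} (quotient q refl) (quotient r refl) = quotient (b * r + q * d + q * r * t) (identity t b d q r)
  where
  identity : ∀ t b d q r → (b + q * t) * (d + r * t) ≡ b * d + (b * r + q * d + q * r * t) * t
  identity = solve-∀

≈-neg : ∀ {t a b} → a ≈ b [mod t ] → - a ≈ - b [mod t ]
≈-neg {t} {_} {b} (quotient q refl) = quotient (- q) (identity t b q)
  where
  identity : ∀ t b q → - (b + q * t) ≡ - b + (- q) * t
  identity = solve-∀

≈-pow : ∀ {t a b} n → a ≈ b [mod t ] → pow a n ≈ pow b n [mod t ]
≈-pow zero e = ≈-reflexive refl
≈-pow (suc n) e = ≈-* e (≈-pow n e)

-- Stands in for being a polynomial function: a function with this property is determined by its values off the
-- hyperplane x_i = x_{i+1}.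
Congruent : (Point → ℤ) → Set
Congruent f = ∀ t {x y} → (∀ i → x i ≈ y i [mod t ]) → f x ≈ f y [mod t ]

evalMono-congruent : ∀ e → Congruent (λ x → evalMono x e)
evalMono-congruent [] t x≈y = ≈-reflexive refl
evalMono-congruent (n ∷ e) t x≈y = ≈-* (≈-pow n (x≈y 0)) (evalMono-congruent e t (λ i → x≈y (suc i)))

eval-congruent : ∀ f → Congruent (λ x → eval x f)
eval-congruent [] t x≈y = ≈-reflexive refl
eval-congruent ((c , e) ∷ f) t x≈y =
  ≈-+ (≈-* (≈-reflexive {a = c} refl) (evalMono-congruent e t x≈y)) (eval-congruent f t x≈y)

bump : ℕ → ℤ → Point → Point
bump zero t x zero = x 0 + t
bump zero t x (suc j) = x (suc j)
bump (suc i) t x zero = x 0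
bump (suc i) t x (suc j) = bump i t (tail x) j

bump-≈ : ∀ i t x j → bump i t x j ≈ x j [mod t ]
bump-≈ zero t x zero = quotient 1ℤ (cong (_+_ (x 0)) (sym (ℤₚ.*-identityˡ t)))
bump-≈ zero t x (suc j) = ≈-reflexive refl
bump-≈ (suc i) t x zero = ≈-reflexive refl
bump-≈ (suc i) t x (suc j) = bump-≈ i t (tail x) j

bump-diff : ∀ i t x → bump i t x i - bump i t x (suc i) ≡ (x i - x (suc i)) + t
bump-diff zero t x = identity (x 0) (x 1) t
  where
  identity : ∀ a b t → (a + t) - b ≡ (a - b) + t
  identity = solve-∀
bump-diff (suc i) t x = bump-diff i t (tail x)

-- The modulus exceeds ∣ d ∣, so every nonzero multiple of it is too large.
small-multiple : ∀ d k → d ≡ k * + suc ∣ d ∣ → d ≡ 0ℤ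
small-multiple d k eq = ℤₚ.∣i∣≡0⇒i≡0 (go ∣ k ∣ (trans (cong ∣_∣ eq) (ℤₚ.abs-* k (+ suc ∣ d ∣))))
  where
  go : ∀ n → ∣ d ∣ ≡ n *ℕ suc ∣ d ∣ → ∣ d ∣ ≡ 0
  go zero e = e
  go (suc n) e = ⊥-elim (ℕₚ.<-irrefl e (ℕₚ.m≤m+n (suc ∣ d ∣) (n *ℕ suc ∣ d ∣)))

*-cancel-≢0 : ∀ d {a b} → d ≢ 0ℤ → d * a ≡ d * b → a ≡ b
*-cancel-≢0 (+ zero) d≢0 _ = ⊥-elim (d≢0 refl)
*-cancel-≢0 (+ suc n) {a} {b} _ eq = ℤₚ.*-cancelˡ-≡ (+ suc n) a b eq
*-cancel-≢0 (ℤ.negsuc n) {a} {b} _ eq = ℤₚ.*-cancelˡ-≡ (ℤ.negsuc n) a b eq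

-- On the hyperplane x_i = x_{i+1}, move x_i by t = ∣f x − g x∣ + 1: then f and g agree, so t divides f x − g x.
cancel-difference : ∀ i {f g} → Congruent f → Congruent g →
  (∀ x → (x i - x (suc i)) * f x ≡ (x i - x (suc i)) * g x) → ∀ x → f x ≡ g x
cancel-difference i {f} {g} cf cg eq x with x i - x (suc i) ℤₚ.≟ 0ℤ
... | no ≢0 = *-cancel-≢0 (x i - x (suc i)) ≢0 (eq x)
... | yes ≡0 with cf (+ suc ∣ f x - g x ∣) (bump-≈ i (+ suc ∣ f x - g x ∣) x)
               | cg (+ suc ∣ f x - g x ∣) (bump-≈ i (+ suc ∣ f x - g x ∣) x)
...   | quotient q fq | quotient r gr = ℤₚ.i-j≡0⇒i≡j (f x) (g x) (small-multiple (f x - g x) (r - q) diff)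
  where
  t : ℤ
  t = + suc ∣ f x - g x ∣
  y : Point
  y = bump i t x
  y-diff : y i - y (suc i) ≡ t
  y-diff = trans (bump-diff i t x) (trans (cong (_+ t) ≡0) (ℤₚ.+-identityˡ t))
  fy≡gy : f y ≡ g y
  fy≡gy = *-cancel-≢0 t (λ ()) (subst (λ d → d * f y ≡ d * g y) y-diff (eq y))
  solveDiff : ∀ a b q r t → a + q * t ≡ b + r * t → a - b ≡ (r - q) * t
  solveDiff a b q r t e = begin
    a - b                       ≡⟨ id₁ a b (q * t) ⟩
    (a + q * t) - q * t - b     ≡⟨ cong (λ z → z - q * t - b) e ⟩
    (b + r * t) - q * t - b     ≡⟨ id₂ b q r t ⟩
    (r - q) * t                 ∎
    where
    id₁ : ∀ a b c → a - b ≡ (a + c) - c - b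
    id₁ = solve-∀
    id₂ : ∀ b q r t → (b + r * t) - q * t - b ≡ (r - q) * t
    id₂ = solve-∀
  diff : f x - g x ≡ (r - q) * t
  diff = solveDiff (f x) (g x) q r t (trans (sym fq) (trans fy≡gy gr))

-- Stated as a product, so that it makes sense on the hyperplane x_i = x_{i+1} too; among
-- `Congruent` functions it determines `g`, by `cancel-difference`.
IsDividedDifference : ℕ → (Point → ℤ) → (Point → ℤ) → Set
IsDividedDifference i f g = ∀ x → (x i - x (suc i)) * g x ≡ f x - f (transpose i x)

rest : ℕ → List ℕ → Point → ℤ
rest _ [] x = 1ℤ
rest zero (_ ∷ []) x = 1ℤ
rest zero (_ ∷ _ ∷ e) x = evalMono (tail (tail x)) e
rest (suc i) (n ∷ e) x = pow (x 0) n * rest i e (tail x)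

rest-transpose : ∀ i e x → rest i e (transpose i x) ≡ rest i e x
rest-transpose _ [] x = refl
rest-transpose zero (_ ∷ []) x = refl
rest-transpose zero (_ ∷ _ ∷ e) x = refl
rest-transpose (suc i) (n ∷ e) x = cong (pow (x 0) n *_) (rest-transpose i e (tail x))

transpose-here : ∀ i x → transpose i x i ≡ x (suc i)
transpose-here zero x = refl
transpose-here (suc i) x = transpose-here i (tail x)

transpose-next : ∀ i x → transpose i x (suc i) ≡ x i
transpose-next zero x = refl
transpose-next (suc i) x = transpose-next i (tail x)

evalMono-set : ∀ i e α β x →
  evalMono x (set (set e i α) (suc i) β) ≡ pow (x i) α * pow (x (suc i)) β * rest i e x
evalMono-set zero [] α β x = sym (ℤₚ.*-assoc (pow (x 0) α) (pow (x 1) β) 1ℤ)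
evalMono-set zero (_ ∷ []) α β x = sym (ℤₚ.*-assoc (pow (x 0) α) (pow (x 1) β) 1ℤ)
evalMono-set zero (_ ∷ _ ∷ e) α β x = sym (ℤₚ.*-assoc (pow (x 0) α) (pow (x 1) β) _)
evalMono-set (suc i) [] α β x =
  trans (ℤₚ.*-identityˡ _) (evalMono-set i [] α β (tail x))
evalMono-set (suc i) (n ∷ e) α β x =
  trans (cong (pow (x 0) n *_) (evalMono-set i e α β (tail x)))
        (identity (pow (x 0) n) (pow (x (suc i)) α) (pow (x (suc (suc i))) β) (rest i e (tail x)))
  where
  identity : ∀ p a b r → p * (a * b * r) ≡ a * b * (p * r)
  identity = solve-∀

evalMono-split : ∀ i e x →
  evalMono x e ≡ pow (x i) (get e i) * pow (x (suc i)) (get e (suc i)) * rest i e x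
evalMono-split zero [] x = refl
evalMono-split zero (n ∷ []) x = sym (trans (ℤₚ.*-identityʳ _) (cong (pow (x 0) n *_) refl))
evalMono-split zero (n ∷ k ∷ e) x = sym (ℤₚ.*-assoc (pow (x 0) n) (pow (x 1) k) _)
evalMono-split (suc i) [] x = refl
evalMono-split (suc i) (n ∷ e) x =
  trans (cong (pow (x 0) n *_) (evalMono-split i e (tail x)))
        (identity (pow (x 0) n) (pow (x (suc i)) (get e i)) (pow (x (suc (suc i))) (get e (suc i))) (rest i e (tail x)))
  where
  identity : ∀ p a b r → p * (a * b * r) ≡ a * b * (p * r)
  identity = solve-∀

powers : ℤ → ℤ → List (ℕ × ℕ) → ℤ
powers u v [] = 0ℤ
powers u v ((α , β) ∷ l) = pow u α * pow v β + powers u v l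

eval-map-set : ∀ i e c x {g : ℕ × ℕ → ℤ × List ℕ} →
  (∀ α β → g (α , β) ≡ (c , set (set e i α) (suc i) β)) →
  ∀ l → eval x (map g l) ≡ c * rest i e x * powers (x i) (x (suc i)) l
eval-map-set i e c x g≡ [] = sym (ℤₚ.*-zeroʳ (c * rest i e x))
eval-map-set i e c x g≡ ((α , β) ∷ l) rewrite g≡ α β = begin
  c * evalMono x (set (set e i α) (suc i) β) + eval x (map _ l)
    ≡⟨ cong₂ (λ a b → c * a + b) (evalMono-set i e α β x) (eval-map-set i e c x g≡ l) ⟩
  c * (pow (x i) α * pow (x (suc i)) β * rest i e x) + c * rest i e x * powers (x i) (x (suc i)) l
    ≡⟨ identity c (pow (x i) α * pow (x (suc i)) β) (rest i e x) (powers (x i) (x (suc i)) l) ⟩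
  c * rest i e x * (pow (x i) α * pow (x (suc i)) β + powers (x i) (x (suc i)) l) ∎
  where
  identity : ∀ c p r s → c * (p * r) + c * r * s ≡ c * r * (p + s)
  identity = solve-∀

pow-+ : ∀ u m n → pow u (m +ℕ n) ≡ pow u m * pow u n
pow-+ u zero n = sym (ℤₚ.*-identityˡ (pow u n))
pow-+ u (suc m) n = trans (cong (u *_) (pow-+ u m n)) (sym (ℤₚ.*-assoc u (pow u m) (pow u n)))

-- Telescoping of u^n - v^n with the common factor u^b v^c. The induction keeps b and increases c;
-- for n = 0 the list is empty, so the truncated `∸ 1` is harmless.
powers-stepsDown : ∀ u v n b c →
  (u - v) * powers u v (stepsDown n ((n +ℕ b) ∸ 1) c) ≡ pow u b * pow v c * (pow u n - pow v n)
powers-stepsDown u v zero b c = identity u v (pow u b * pow v c)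
  where
  identity : ∀ u v p → (u - v) * 0ℤ ≡ p * (1ℤ - 1ℤ)
  identity = solve-∀
powers-stepsDown u v (suc n) b c = begin
  (u - v) * (pow u (n +ℕ b) * pow v c + S)
    ≡⟨ cong (λ p → (u - v) * (p * pow v c + S)) (pow-+ u n b) ⟩
  (u - v) * (pow u n * pow u b * pow v c + S)
    ≡⟨ ℤₚ.*-distribˡ-+ (u - v) (pow u n * pow u b * pow v c) S ⟩
  (u - v) * (pow u n * pow u b * pow v c) + (u - v) * S
    ≡⟨ cong (_+_ ((u - v) * (pow u n * pow u b * pow v c))) (powers-stepsDown u v n b (suc c)) ⟩
  (u - v) * (pow u n * pow u b * pow v c) + pow u b * (v * pow v c) * (pow u n - pow v n)
    ≡⟨ identity u v (pow u n) (pow u b) (pow v c) (pow v n) ⟩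
  pow u b * pow v c * (u * pow u n - v * pow v n) ∎
  where
  S : ℤ
  S = powers u v (stepsDown n ((n +ℕ b) ∸ 1) (suc c))
  identity : ∀ u v un ub vc vn →
    (u - v) * (un * ub * vc) + ub * (v * vc) * (un - vn) ≡ ub * vc * (u * un - v * vn)
  identity = solve-∀

powers-stepsUp : ∀ u v n b c →
  (u - v) * powers u v (stepsUp n b ((n +ℕ c) ∸ 1)) ≡ pow u b * pow v c * (pow u n - pow v n)
powers-stepsUp u v zero b c = identity u v (pow u b * pow v c)
  where
  identity : ∀ u v p → (u - v) * 0ℤ ≡ p * (1ℤ - 1ℤ)
  identity = solve-∀
powers-stepsUp u v (suc n) b c = begin
  (u - v) * (pow u b * pow v (n +ℕ c) + S)
    ≡⟨ cong (λ p → (u - v) * (pow u b * p + S)) (pow-+ v n c) ⟩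
  (u - v) * (pow u b * (pow v n * pow v c) + S)
    ≡⟨ ℤₚ.*-distribˡ-+ (u - v) (pow u b * (pow v n * pow v c)) S ⟩
  (u - v) * (pow u b * (pow v n * pow v c)) + (u - v) * S
    ≡⟨ cong (_+_ ((u - v) * (pow u b * (pow v n * pow v c)))) (powers-stepsUp u v n (suc b) c) ⟩
  (u - v) * (pow u b * (pow v n * pow v c)) + u * pow u b * pow v c * (pow u n - pow v n)
    ≡⟨ identity u v (pow u n) (pow u b) (pow v c) (pow v n) ⟩
  pow u b * pow v c * (u * pow u n - v * pow v n) ∎
  where
  S : ℤ
  S = powers u v (stepsUp n (suc b) ((n +ℕ c) ∸ 1))
  identity : ∀ u v un ub vc vn →
    (u - v) * (ub * (vn * vc)) + u * ub * vc * (un - vn) ≡ ub * vc * (u * un - v * vn)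
  identity = solve-∀

<ᵇ-true : ∀ {m n} → m < n → (m <ᵇ n) ≡ true
<ᵇ-true {m} {n} m<n with m <ᵇ n | ℕₚ.<⇒<ᵇ m<n
... | true | _ = refl

<ᵇ-false : ∀ {m n} → n ≤ m → (m <ᵇ n) ≡ false
<ᵇ-false {m} {n} n≤m with m <ᵇ n in eq
... | false = refl
... | true = ⊥-elim (ℕₚ.≤⇒≯ n≤m (ℕₚ.<ᵇ⇒< m n (subst T (sym eq) tt)))

<ᵇ-true⁻¹ : ∀ {m n} → (m <ᵇ n) ≡ true → m < n
<ᵇ-true⁻¹ {m} {n} eq = ℕₚ.<ᵇ⇒< m n (subst T (sym eq) tt)

<ᵇ-false⁻¹ : ∀ {m n} → (m <ᵇ n) ≡ false → n ≤ m
<ᵇ-false⁻¹ eq = ℕₚ.≮⇒≥ λ m<n → true≢false (trans (sym (<ᵇ-true m<n)) eq)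
  where
  true≢false : true ≢ false
  true≢false ()

pow-∸ : ∀ u {a b} → b ≤ a → pow u a ≡ pow u (a ∸ b) * pow u b
pow-∸ u {a} {b} b≤a = trans (cong (pow u) (sym (ℕₚ.m∸n+n≡m b≤a))) (pow-+ u (a ∸ b) b)

antisymmetrized-down : ∀ u v c r {a b} → b ≤ a →
  (u - v) * (c * r * powers u v (stepsDown (a ∸ b) (a ∸ 1) b))
    ≡ c * (pow u a * pow v b * r) - c * (pow v a * pow u b * r)
antisymmetrized-down u v c r {a} {b} b≤a = begin
  (u - v) * (c * r * powers u v (stepsDown n (a ∸ 1) b))
    ≡⟨ cong (λ z → (u - v) * (c * r * powers u v (stepsDown n (z ∸ 1) b))) (sym (ℕₚ.m∸n+n≡m b≤a)) ⟩
  (u - v) * (c * r * S)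
    ≡⟨ assoc (u - v) (c * r) S ⟩
  c * r * ((u - v) * S)
    ≡⟨ cong (c * r *_) (powers-stepsDown u v n b b) ⟩
  c * r * (pow u b * pow v b * (pow u n - pow v n))
    ≡⟨ identity c r (pow u b) (pow v b) (pow u n) (pow v n) ⟩
  c * (pow u n * pow u b * pow v b * r) - c * (pow v n * pow v b * pow u b * r)
    ≡⟨ cong₂ (λ p q → c * (p * pow v b * r) - c * (q * pow u b * r)) (sym (pow-∸ u b≤a)) (sym (pow-∸ v b≤a)) ⟩
  c * (pow u a * pow v b * r) - c * (pow v a * pow u b * r) ∎
  where
  n : ℕ
  n = a ∸ b
  S : ℤ
  S = powers u v (stepsDown n ((n +ℕ b) ∸ 1) b)
  assoc : ∀ d e s → d * (e * s) ≡ e * (d * s)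
  assoc = solve-∀
  identity : ∀ c r ub vb un vn →
    c * r * (ub * vb * (un - vn)) ≡ c * (un * ub * vb * r) - c * (vn * vb * ub * r)
  identity = solve-∀

antisymmetrized-up : ∀ u v c r {a b} → a ≤ b →
  (u - v) * (- c * r * powers u v (stepsUp (b ∸ a) a (b ∸ 1)))
    ≡ c * (pow u a * pow v b * r) - c * (pow v a * pow u b * r)
antisymmetrized-up u v c r {a} {b} a≤b = begin
  (u - v) * (- c * r * powers u v (stepsUp n a (b ∸ 1)))
    ≡⟨ cong (λ z → (u - v) * (- c * r * powers u v (stepsUp n a (z ∸ 1)))) (sym (ℕₚ.m∸n+n≡m a≤b)) ⟩
  (u - v) * (- c * r * S)
    ≡⟨ assoc (u - v) (- c * r) S ⟩
  - c * r * ((u - v) * S)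
    ≡⟨ cong (- c * r *_) (powers-stepsUp u v n a a) ⟩
  - c * r * (pow u a * pow v a * (pow u n - pow v n))
    ≡⟨ identity c r (pow u a) (pow v a) (pow u n) (pow v n) ⟩
  c * (pow u a * (pow v n * pow v a) * r) - c * (pow v a * (pow u n * pow u a) * r)
    ≡⟨ cong₂ (λ p q → c * (pow u a * p * r) - c * (pow v a * q * r)) (sym (pow-∸ v a≤b)) (sym (pow-∸ u a≤b)) ⟩
  c * (pow u a * pow v b * r) - c * (pow v a * pow u b * r) ∎
  where
  n : ℕ
  n = b ∸ a
  S : ℤ
  S = powers u v (stepsUp n a ((n +ℕ a) ∸ 1))
  assoc : ∀ d e s → d * (e * s) ≡ e * (d * s)
  assoc = solve-∀
  identity : ∀ c r ua va un vn →
    - c * r * (ua * va * (un - vn)) ≡ c * (ua * (vn * va) * r) - c * (va * (un * ua) * r)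
  identity = solve-∀

antisymmetrized-equal : ∀ d u v c r {a b} → a ≡ b →
  d * 0ℤ ≡ c * (pow u a * pow v b * r) - c * (pow v a * pow u b * r)
antisymmetrized-equal d u v c r {a} refl = identity d c (pow u a) (pow v a) r
  where
  identity : ∀ d c p q r → d * 0ℤ ≡ c * (p * q * r) - c * (q * p * r)
  identity = solve-∀

eval-++ : ∀ x f g → eval x (f ++ g) ≡ eval x f + eval x g
eval-++ x [] g = sym (ℤₚ.+-identityˡ (eval x g))
eval-++ x ((c , e) ∷ f) g =
  trans (cong (_+_ (c * evalMono x e)) (eval-++ x f g)) (sym (ℤₚ.+-assoc (c * evalMono x e) (eval x f) (eval x g)))

evalMono-transpose : ∀ i e x →
  evalMono (transpose i x) e ≡ pow (x (suc i)) (get e i) * pow (x i) (get e (suc i)) * rest i e x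
evalMono-transpose i e x
  rewrite evalMono-split i e (transpose i x) | transpose-here i x | transpose-next i x | rest-transpose i e x = refl

eval-ddTerm : ∀ i c e x → (x i - x (suc i)) * eval x (ddTerm i (c , e)) ≡ c * evalMono x e - c * evalMono (transpose i x) e
eval-ddTerm i c e x
  rewrite evalMono-split i e x | evalMono-transpose i e x
  with get e (suc i) <ᵇ get e i in b<a
... | true =
  trans (cong ((x i - x (suc i)) *_) (eval-map-set i e c x (λ _ _ → refl) (stepsDown (get e i ∸ get e (suc i)) (get e i ∸ 1) (get e (suc i)))))
        (antisymmetrized-down (x i) (x (suc i)) c (rest i e x) (ℕₚ.<⇒≤ (<ᵇ-true⁻¹ {get e (suc i)} {get e i} b<a)))
... | false with get e i <ᵇ get e (suc i) in a<b
...   | true =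
  trans (cong ((x i - x (suc i)) *_) (eval-map-set i e (- c) x (λ _ _ → refl) (stepsUp (get e (suc i) ∸ get e i) (get e i) (get e (suc i) ∸ 1))))
        (antisymmetrized-up (x i) (x (suc i)) c (rest i e x) (ℕₚ.<⇒≤ (<ᵇ-true⁻¹ {get e i} {get e (suc i)} a<b)))
...   | false =
  antisymmetrized-equal (x i - x (suc i)) (x i) (x (suc i)) c (rest i e x)
    (ℕₚ.≤-antisym (<ᵇ-false⁻¹ {get e (suc i)} {get e i} b<a) (<ᵇ-false⁻¹ {get e i} {get e (suc i)} a<b))

eval-dd : ∀ i f → IsDividedDifference i (λ x → eval x f) (λ x → eval x (dd i f))
eval-dd i [] x = ℤₚ.*-zeroʳ (x i - x (suc i))
eval-dd i ((c , e) ∷ f) x = begin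
  d * eval x (ddTerm i (c , e) ++ dd i f)
    ≡⟨ cong (d *_) (eval-++ x (ddTerm i (c , e)) (dd i f)) ⟩
  d * (eval x (ddTerm i (c , e)) + eval x (dd i f))
    ≡⟨ ℤₚ.*-distribˡ-+ d _ _ ⟩
  d * eval x (ddTerm i (c , e)) + d * eval x (dd i f)
    ≡⟨ cong₂ _+_ (eval-ddTerm i c e x) (eval-dd i f x) ⟩
  (c * evalMono x e - c * evalMono (transpose i x) e) + (eval x f - eval (transpose i x) f)
    ≡⟨ identity (c * evalMono x e) (c * evalMono (transpose i x) e) (eval x f) (eval (transpose i x) f) ⟩
  (c * evalMono x e + eval x f) - (c * evalMono (transpose i x) e + eval (transpose i x) f) ∎
  where
  d : ℤ
  d = x i - x (suc i)
  identity : ∀ a b c d → (a - b) + (c - d) ≡ (a + c) - (b + d)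
  identity = solve-∀

-- Schubert polynomials along the chain of first ascents

larger : ℕ → Perm → ℕ
larger x [] = 0
larger x (y ∷ w) = if x <ᵇ y then suc (larger x w) else larger x w

-- The length of the remaining chain, hence the fuel that `schubertAux` consumes: a swap at the
-- first ascent lowers it by exactly one.
nonInversions : Perm → ℕ
nonInversions [] = 0
nonInversions (x ∷ w) = larger x w +ℕ nonInversions w

larger-swapAt : ∀ x i w → larger x (swapAt i w) ≡ larger x w
larger-swapAt x zero [] = refl
larger-swapAt x zero (_ ∷ []) = refl
larger-swapAt x zero (y ∷ z ∷ w) with x <ᵇ y | x <ᵇ z
... | true | true = refl
... | true | false = refl
... | false | true = refl
... | false | false = refl
larger-swapAt x (suc i) [] = refl
larger-swapAt x (suc i) (y ∷ w) with x <ᵇ y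
... | true = cong suc (larger-swapAt x i w)
... | false = larger-swapAt x i w

nonInversions-swapAt : ∀ w {i} → firstAscent w ≡ just i → nonInversions w ≡ suc (nonInversions (swapAt i w))
nonInversions-swapAt (x ∷ y ∷ w) asc with x <ᵇ y in x<y
nonInversions-swapAt (x ∷ y ∷ w) refl | true
  rewrite <ᵇ-false (ℕₚ.<⇒≤ (<ᵇ-true⁻¹ {x} {y} x<y)) = cong suc (begin
    larger x w +ℕ (larger y w +ℕ nonInversions w)  ≡⟨ sym (ℕₚ.+-assoc (larger x w) _ _) ⟩
    (larger x w +ℕ larger y w) +ℕ nonInversions w  ≡⟨ cong (_+ℕ nonInversions w) (ℕₚ.+-comm (larger x w) _) ⟩
    (larger y w +ℕ larger x w) +ℕ nonInversions w  ≡⟨ ℕₚ.+-assoc (larger y w) _ _ ⟩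
    larger y w +ℕ (larger x w +ℕ nonInversions w)  ∎)
nonInversions-swapAt (x ∷ y ∷ w) asc | false with firstAscent (y ∷ w) in asc′
nonInversions-swapAt (x ∷ y ∷ w) refl | false | just i = begin
  larger x w +ℕ nonInversions (y ∷ w)
    ≡⟨ cong₂ _+ℕ_ unchanged (nonInversions-swapAt (y ∷ w) asc′) ⟩
  larger x (swapAt i (y ∷ w)) +ℕ suc (nonInversions (swapAt i (y ∷ w)))
    ≡⟨ ℕₚ.+-suc (larger x (swapAt i (y ∷ w))) _ ⟩
  suc (larger x (swapAt i (y ∷ w)) +ℕ nonInversions (swapAt i (y ∷ w))) ∎
  where
  unchanged : larger x w ≡ larger x (swapAt i (y ∷ w))
  unchanged = trans (sym (cong (λ b → if b then suc (larger x w) else larger x w) x<y))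
                    (sym (larger-swapAt x i (y ∷ w)))

larger-≤ : ∀ x w → larger x w ≤ length w
larger-≤ x [] = z≤n
larger-≤ x (y ∷ w) with x <ᵇ y
... | true = s≤s (larger-≤ x w)
... | false = ℕₚ.m≤n⇒m≤1+n (larger-≤ x w)

nonInversions-≤ : ∀ w → nonInversions w ≤ length w *ℕ length w
nonInversions-≤ [] = z≤n
nonInversions-≤ (x ∷ w) =
  ℕₚ.+-mono-≤ (ℕₚ.m≤n⇒m≤1+n (larger-≤ x w))
    (ℕₚ.≤-trans (nonInversions-≤ w) (ℕₚ.*-monoʳ-≤ (length w) (ℕₚ.n≤1+n (length w))))

-- Quantified over every sufficient fuel, because inside the chain of another permutation the fuel
-- is not the square of the length.
IsSchubert : Perm → (Point → ℤ) → Set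
IsSchubert w g = ∀ fuel → nonInversions w ≤ fuel → ∀ x → eval x (schubertAux fuel w) ≡ g x

IsSchubert-eval : ∀ {w g} → IsSchubert w g → ∀ x → eval x (schubert w) ≡ g x
IsSchubert-eval {w} isS = isS (length w *ℕ length w) (nonInversions-≤ w)

IsSchubert-cong : ∀ {w f g} → (∀ x → f x ≡ g x) → IsSchubert w f → IsSchubert w g
IsSchubert-cong f≡g isS fuel bound x = trans (isS fuel bound x) (f≡g x)

schubertAux-nothing : ∀ fuel w → firstAscent w ≡ nothing → schubertAux fuel w ≡ (1ℤ , stair (length w)) ∷ []
schubertAux-nothing fuel w asc rewrite asc = refl

schubertAux-just : ∀ fuel w {i} → firstAscent w ≡ just i → schubertAux (suc fuel) w ≡ dd i (schubertAux fuel (swapAt i w))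
schubertAux-just fuel w asc rewrite asc = refl

schubertAux-stuck : ∀ w {i} → firstAscent w ≡ just i → schubertAux zero w ≡ []
schubertAux-stuck w asc rewrite asc = refl

-- `g` and the evaluation of `dd i` satisfy the same product equation, and both are `Congruent`, so
-- the factor x_i - x_{i+1} cancels.
IsSchubert-swapAt : ∀ {w i f g} → firstAscent w ≡ just i → IsSchubert (swapAt i w) f →
  IsDividedDifference i f g → Congruent g → IsSchubert w g
IsSchubert-swapAt {w} {i} {f} {g} asc isS isD cg fuel bound x
  with fuel | subst (_≤ fuel) (nonInversions-swapAt w asc) bound
... | suc fuel′ | s≤s bound′ rewrite schubertAux-just fuel′ w asc =
  cancel-difference i (eval-congruent (dd i P)) cg agree x
  where
  P : Poly
  P = schubertAux fuel′ (swapAt i w)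
  agree : ∀ y → (y i - y (suc i)) * eval y (dd i P) ≡ (y i - y (suc i)) * g y
  agree y = begin
    (y i - y (suc i)) * eval y (dd i P)     ≡⟨ eval-dd i P y ⟩
    eval y P - eval (transpose i y) P       ≡⟨ cong₂ _-_ (isS fuel′ bound′ y) (isS fuel′ bound′ (transpose i y)) ⟩
    f y - f (transpose i y)                 ≡⟨ sym (isD y) ⟩
    (y i - y (suc i)) * g y                 ∎

swapAt-All : ∀ {p} {P : ℕ → Set p} i {w} → All P w → All P (swapAt i w)
swapAt-All zero [] = []
swapAt-All zero (p ∷ []) = p ∷ []
swapAt-All zero (p ∷ q ∷ ps) = q ∷ p ∷ ps
swapAt-All (suc i) [] = []
swapAt-All (suc i) (p ∷ ps) = p ∷ swapAt-All i ps

length-swapAt : ∀ i w → length (swapAt i w) ≡ length w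
length-swapAt zero [] = refl
length-swapAt zero (_ ∷ []) = refl
length-swapAt zero (_ ∷ _ ∷ _) = refl
length-swapAt (suc i) [] = refl
length-swapAt (suc i) (_ ∷ w) = cong suc (length-swapAt i w)

firstAscent-∷ : ∀ {y w} → All (_< y) w → firstAscent (y ∷ w) ≡ Data.Maybe.map suc (firstAscent w)
firstAscent-∷ [] = refl
firstAscent-∷ {y} {z ∷ w} (z<y ∷ _) rewrite <ᵇ-false (ℕₚ.<⇒≤ z<y) = refl

-- A leading maximum takes part in no ascent, so the chain runs inside `w` with all indices raised
-- by one. Insufficient fuel does no harm: where the chain is cut off, both sides are 0.
eval-schubertAux-∷ : ∀ fuel {y} w → All (_< y) w → ∀ x →
  eval x (schubertAux fuel (y ∷ w)) ≡ pow (x 0) (length w) * eval (tail x) (schubertAux fuel w)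
eval-schubertAux-∷ fuel {y} w w<y x with firstAscent w in asc
... | nothing
  rewrite schubertAux-nothing fuel (y ∷ w) (trans (firstAscent-∷ w<y) (cong (Data.Maybe.map suc) asc)) =
  identity (pow (x 0) (length w)) (evalMono (tail x) (stair (length w)))
  where
  identity : ∀ p e → 1ℤ * (p * e) + 0ℤ ≡ p * (1ℤ * e + 0ℤ)
  identity = solve-∀
eval-schubertAux-∷ zero {y} w w<y x | just i
  rewrite schubertAux-stuck (y ∷ w) (trans (firstAscent-∷ w<y) (cong (Data.Maybe.map suc) asc)) =
  sym (ℤₚ.*-zeroʳ (pow (x 0) (length w)))
eval-schubertAux-∷ (suc fuel) {y} w w<y x | just i
  rewrite schubertAux-just fuel (y ∷ w) (trans (firstAscent-∷ w<y) (cong (Data.Maybe.map suc) asc)) =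
  cancel-difference (suc i) (eval-congruent (dd (suc i) (schubertAux fuel (y ∷ swapAt i w))))
    (λ t x≈y → ≈-* (≈-pow (length w) (x≈y 0)) (eval-congruent (dd i P) t (λ j → x≈y (suc j)))) agree x
  where
  P : Poly
  P = schubertAux fuel (swapAt i w)
  induction : ∀ z → eval z (schubertAux fuel (y ∷ swapAt i w)) ≡ pow (z 0) (length w) * eval (tail z) P
  induction z = trans (eval-schubertAux-∷ fuel (swapAt i w) (swapAt-All i w<y) z)
                      (cong (λ n → pow (z 0) n * eval (tail z) P) (length-swapAt i w))
  factor : ∀ p a b → p * a - p * b ≡ p * (a - b)
  factor = solve-∀
  move : ∀ d p e → p * (d * e) ≡ d * (p * e)
  move = solve-∀
  agree : ∀ z → (z (suc i) - z (suc (suc i))) * eval z (dd (suc i) (schubertAux fuel (y ∷ swapAt i w)))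
              ≡ (z (suc i) - z (suc (suc i))) * (pow (z 0) (length w) * eval (tail z) (dd i P))
  agree z = begin
    (z (suc i) - z (suc (suc i))) * eval z (dd (suc i) (schubertAux fuel (y ∷ swapAt i w)))
      ≡⟨ eval-dd (suc i) (schubertAux fuel (y ∷ swapAt i w)) z ⟩
    eval z (schubertAux fuel (y ∷ swapAt i w)) - eval (transpose (suc i) z) (schubertAux fuel (y ∷ swapAt i w))
      ≡⟨ cong₂ _-_ (induction z) (induction (transpose (suc i) z)) ⟩
    pow (z 0) (length w) * eval (tail z) P - pow (z 0) (length w) * eval (transpose i (tail z)) P
      ≡⟨ factor (pow (z 0) (length w)) (eval (tail z) P) (eval (transpose i (tail z)) P) ⟩
    pow (z 0) (length w) * (eval (tail z) P - eval (transpose i (tail z)) P)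
      ≡⟨ cong (pow (z 0) (length w) *_) (sym (eval-dd i P (tail z))) ⟩
    pow (z 0) (length w) * ((z (suc i) - z (suc (suc i))) * eval (tail z) (dd i P))
      ≡⟨ move (z (suc i) - z (suc (suc i))) (pow (z 0) (length w)) (eval (tail z) (dd i P)) ⟩
    (z (suc i) - z (suc (suc i))) * (pow (z 0) (length w) * eval (tail z) (dd i P)) ∎

IsSchubert-∷ : ∀ {w y g} → All (_< y) w → IsSchubert w g →
  IsSchubert (y ∷ w) (λ x → pow (x 0) (length w) * g (tail x))
IsSchubert-∷ {w} {y} w<y isS fuel bound x =
  trans (eval-schubertAux-∷ fuel w w<y x)
        (cong (pow (x 0) (length w) *_) (isS fuel (ℕₚ.m+n≤o⇒n≤o (larger y w) bound) (tail x)))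

-- The monomial x_0^{a-1} ⋯ x_{j-1}^{a-j} · x_j^{a-j} ⋯ x_{a-1}^1, which interpolates between
-- 𝔖_{w_0(a+1)} (j = 0) and 𝔖_{w_0(a)} (j = a).
weight : ℕ → ℕ → Point → ℤ
weight a zero x = evalMono x (stair (suc a))
weight zero (suc j) x = 1ℤ
weight (suc a) (suc j) x = pow (x 0) a * weight a j (tail x)

weight-diagonal : ∀ a x → weight a a x ≡ evalMono x (stair a)
weight-diagonal zero x = refl
weight-diagonal (suc a) x = cong (pow (x 0) a *_) (weight-diagonal a (tail x))

weight-suc : ∀ {a j} → j < a → ∀ x → weight a j x ≡ x j * weight a (suc j) x
weight-suc {suc a} {zero} _ x = ℤₚ.*-assoc (x 0) (pow (x 0) a) _
weight-suc {suc a} {suc j} (s≤s j<a) x =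
  trans (cong (pow (x 0) a *_) (weight-suc j<a (tail x)))
        (identity (pow (x 0) a) (x (suc j)) (weight a (suc j) (tail x)))
  where
  identity : ∀ p u w → p * (u * w) ≡ u * (p * w)
  identity = solve-∀

weight-transpose : ∀ {a j} → j < a → ∀ x → weight a (suc j) (transpose j x) ≡ weight a (suc j) x
weight-transpose {suc a} {zero} _ x = identity (pow (x 1) a) (pow (x 0) a) (evalMono (tail (tail x)) (stair a))
  where
  identity : ∀ p q e → p * (q * e) ≡ q * (p * e)
  identity = solve-∀
weight-transpose {suc a} {suc j} (s≤s j<a) x = cong (pow (x 0) a *_) (weight-transpose j<a (tail x))

weight-congruent : ∀ a j → Congruent (weight a j)
weight-congruent a zero = evalMono-congruent (stair (suc a))
weight-congruent zero (suc j) t x≈y = ≈-reflexive refl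
weight-congruent (suc a) (suc j) t x≈y = ≈-* (≈-pow a (x≈y 0)) (weight-congruent a j t (λ i → x≈y (suc i)))

-- The isobaric divided difference (Demazure operator) g = ∂_j (x_j f), again as a product.
IsIsobaric : ℕ → (Point → ℤ) → (Point → ℤ) → Set
IsIsobaric j f g = ∀ x → (x j - x (suc j)) * g x ≡ x j * f x - x (suc j) * f (transpose j x)

IsIsobaric-symmetric : ∀ {j f} → (∀ x → f (transpose j x) ≡ f x) → IsIsobaric j f f
IsIsobaric-symmetric {j} {f} sym-f x rewrite sym-f x = identity (x j) (x (suc j)) (f x)
  where
  identity : ∀ u v p → (u - v) * p ≡ u * p - v * p
  identity = solve-∀

-- `weight a j` is x_j times `weight a (suc j)`. The latter is symmetric in x_j and x_{j+1} and
-- comes out of ∂_j; the extra x_j turns ∂_j into the isobaric operator.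
weighted-dividedDifference : ∀ {a j f g} → j < a → IsIsobaric j f g →
  IsDividedDifference j (λ x → weight a j x * f x) (λ x → weight a (suc j) x * g x)
weighted-dividedDifference {a} {j} {f} {g} j<a iso x = begin
  (u - v) * (W * g x)                               ≡⟨ commute (u - v) W (g x) ⟩
  W * ((u - v) * g x)                               ≡⟨ cong (W *_) (iso x) ⟩
  W * (u * f x - v * f y)                           ≡⟨ expand W u v (f x) (f y) ⟩
  u * W * f x - v * W * f y
    ≡⟨ cong₂ (λ p q → p * f x - q * f y) (sym (weight-suc j<a x)) (sym weight-y) ⟩
  weight a j x * f x - weight a j y * f y           ∎
  where
  u v W : ℤ
  u = x j
  v = x (suc j)
  W = weight a (suc j) x
  y : Point
  y = transpose j x
  weight-y : weight a j y ≡ v * W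
  weight-y = trans (weight-suc j<a y) (cong₂ _*_ (transpose-here j x) (weight-transpose j<a x))
  commute : ∀ d w p → d * (w * p) ≡ w * (d * p)
  commute = solve-∀
  expand : ∀ w u v p q → w * (u * p - v * q) ≡ u * w * p - v * w * q
  expand = solve-∀

firstAscent-∷⁻¹ : ∀ x y w → firstAscent (x ∷ y ∷ w) ≡ nothing → y ≤ x × firstAscent (y ∷ w) ≡ nothing
firstAscent-∷⁻¹ x y w eq with x <ᵇ y in x<y
... | false with firstAscent (y ∷ w)
...   | nothing = <ᵇ-false⁻¹ {x} {y} x<y , refl

firstAscent-≥ : ∀ {x y} → y ≤ x → ∀ w → firstAscent (x ∷ y ∷ w) ≡ Data.Maybe.map suc (firstAscent (y ∷ w))
firstAscent-≥ y≤x w rewrite <ᵇ-false y≤x = refl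

firstAscent-++ : ∀ v {p y} w r → firstAscent (v ++ p ∷ w) ≡ nothing → p < y →
  firstAscent (v ++ p ∷ y ∷ r) ≡ just (length v)
firstAscent-++ [] w r desc p<y rewrite <ᵇ-true p<y = refl
firstAscent-++ (q ∷ []) {p} {y} w r desc p<y =
  trans (firstAscent-≥ (proj₁ (firstAscent-∷⁻¹ q p w desc)) (y ∷ r))
        (cong (Data.Maybe.map suc) (firstAscent-++ [] w r (proj₂ (firstAscent-∷⁻¹ q p w desc)) p<y))
firstAscent-++ (q ∷ q′ ∷ v) {p} {y} w r desc p<y =
  trans (firstAscent-≥ (proj₁ (firstAscent-∷⁻¹ q q′ (v ++ p ∷ w) desc)) (v ++ p ∷ y ∷ r))
        (cong (Data.Maybe.map suc)
              (firstAscent-++ (q′ ∷ v) w r (proj₂ (firstAscent-∷⁻¹ q q′ (v ++ p ∷ w) desc)) p<y))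

swapAt-++ : ∀ v {p y} r → swapAt (length v) (v ++ p ∷ y ∷ r) ≡ v ++ y ∷ p ∷ r
swapAt-++ [] r = refl
swapAt-++ (q ∷ v) r = cong (q ∷_) (swapAt-++ v r)

-- `v` is the part that `y` has already passed. While v ++ w is descending and w lies below `y`, the
-- first ascent after a move is exactly at `y`, so each move undoes the very step that `schubertAux`
-- takes.
IsSchubert-insert′ : ∀ v w {y r a} (g : ℕ → Point → ℤ) → firstAscent (v ++ w) ≡ nothing → All (_< y) w →
  length v +ℕ length w ≡ a →
  (∀ {j} → j < a → IsIsobaric j (g j) (g (suc j))) → (∀ j → Congruent (g j)) →
  IsSchubert (v ++ y ∷ w ++ r) (λ x → weight a (length v) x * g (length v) x) →
  IsSchubert (v ++ w ++ y ∷ r) (λ x → evalMono x (stair a) * g a x)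
IsSchubert-insert′ v [] {a = a} g desc _ refl iso cg isS =
  IsSchubert-cong {v ++ _ ∷ _} (λ x → subst (λ j → weight j (length v) x * g (length v) x ≡ evalMono x (stair j) * g j x)
                               (sym (ℕₚ.+-identityʳ (length v)))
                               (cong (_* g (length v) x) (weight-diagonal (length v) x)))
                  isS
IsSchubert-insert′ v (p ∷ w) {y} {r} {a} g desc (p<y ∷ w<y) len iso cg isS =
  subst (λ z → IsSchubert z (λ x → evalMono x (stair a) * g a x)) (++-assoc v (p ∷ []) (w ++ y ∷ r))
    (IsSchubert-insert′ (v ++ p ∷ []) w g (trans (cong firstAscent (++-assoc v (p ∷ []) w)) desc) w<y
      (trans (cong (_+ℕ length w) length-v′) (trans (sym (ℕₚ.+-suc (length v) (length w))) len)) iso cg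
      (subst (λ j → IsSchubert ((v ++ p ∷ []) ++ y ∷ w ++ r) (λ x → weight a j x * g j x)) (sym length-v′)
        (subst (λ z → IsSchubert z (λ x → weight a (suc (length v)) x * g (suc (length v)) x))
               (sym (++-assoc v (p ∷ []) (y ∷ w ++ r)))
               (IsSchubert-swapAt (firstAscent-++ v w (w ++ r) desc p<y)
                 (subst (λ z → IsSchubert z (λ x → weight a (length v) x * g (length v) x))
                        (sym (swapAt-++ v (w ++ r))) isS)
                 (weighted-dividedDifference v<a (iso v<a))
                 (λ t x≈y → ≈-* (weight-congruent a (suc (length v)) t x≈y) (cg (suc (length v)) t x≈y))))))
  where
  length-v′ : length (v ++ p ∷ []) ≡ suc (length v)
  length-v′ = trans (length-++ v) (ℕₚ.+-comm (length v) 1)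
  v<a : length v < a
  v<a = subst (length v <_) len (ℕₚ.m<m+n (length v) (s≤s z≤n))

IsSchubert-insert : ∀ w {y r a} (g : ℕ → Point → ℤ) → firstAscent w ≡ nothing → All (_< y) w → length w ≡ a →
  (∀ {j} → j < a → IsIsobaric j (g j) (g (suc j))) → (∀ j → Congruent (g j)) →
  IsSchubert (y ∷ w ++ r) (λ x → evalMono x (stair (suc a)) * g 0 x) →
  IsSchubert (w ++ y ∷ r) (λ x → evalMono x (stair a) * g a x)
IsSchubert-insert = IsSchubert-insert′ []

-- From w_0(a) × v to 1ᵃ × v

w0-≤ : ∀ p → All (_≤ p) (w0 p)
w0-≤ zero = []
w0-≤ (suc p) = ℕₚ.≤-refl ∷ All.map ℕₚ.m≤n⇒m≤1+n (w0-≤ p)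

w0-descending : ∀ p → firstAscent (w0 p) ≡ nothing
w0-descending zero = refl
w0-descending (suc p) = trans (firstAscent-∷ (All.map s≤s (w0-≤ p))) (cong (Data.Maybe.map suc) (w0-descending p))

length-w0 : ∀ p → length (w0 p) ≡ p
length-w0 zero = refl
length-w0 (suc p) = cong suc (length-w0 p)

range : ℕ → ℕ → List ℕ
range k zero = []
range k (suc n) = k ∷ range (suc k) n

-- `w0 (suc k)` is `suc k` in front of `w0 k`, so each insertion puts one letter in its final place.
-- A symmetric `g` is fixed by the isobaric operators, and only the staircase shrinks.
IsSchubert-sort : ∀ n {k a r g} → n +ℕ k ≡ a → Congruent g → (∀ {j} → suc j < a → ∀ x → g (transpose j x) ≡ g x) →
  IsSchubert (w0 a ++ r) (λ x → evalMono x (stair a) * g x) →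
  IsSchubert (w0 k ++ range (suc k) n ++ r) (λ x → evalMono x (stair k) * g x)
IsSchubert-sort zero refl cg sym-g isS = isS
IsSchubert-sort (suc n) {k} {a} {g = g} len cg sym-g isS =
  IsSchubert-insert (w0 k) (λ _ → g) (w0-descending k) (All.map s≤s (w0-≤ k)) (length-w0 k)
    (λ j<k → IsIsobaric-symmetric {f = g} (sym-g (ℕₚ.≤-trans (s≤s j<k) k<a))) (λ _ → cg)
    (IsSchubert-sort n (trans (ℕₚ.+-suc n k) len) cg sym-g isS)
  where
  k<a : k < a
  k<a = subst (k <_) len (s≤s (ℕₚ.m≤n+m k n))

-- The hole stands for the local function of idPerm, which has no name here; it is found by unification in the next clause.
local-range : ∀ a k n → _ ≡ range k n
idPerm-range : ∀ a → idPerm a ≡ range 1 a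
idPerm-range zero = refl
idPerm-range (suc a) with suc a | 2
... | b | k = cong (1 ∷_) (local-range b k a)
local-range a k zero = refl
local-range a k (suc n) = cong (k ∷_) (local-range a (suc k) n)

IsSchubert-idPerm : ∀ a {r g} → Congruent g → (∀ {j} → suc j < a → ∀ x → g (transpose j x) ≡ g x) →
  IsSchubert (w0 a ++ r) (λ x → evalMono x (stair a) * g x) → IsSchubert (idPerm a ++ r) g
IsSchubert-idPerm a {r} {g} cg sym-g isS rewrite idPerm-range a =
  IsSchubert-cong {range 1 a ++ r} (λ x → ℤₚ.*-identityˡ (g x)) (IsSchubert-sort a (ℕₚ.+-identityʳ a) cg sym-g isS)

-- Determinants

-- Contraction of an alternating form K by the row r: the Laplace expansion along r.
contract : {C : Set} → (C → ℤ) → (List C → ℤ) → List C → ℤ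
contract r K [] = 0ℤ
contract r K (c ∷ l) = r c * K l - contract r (λ l′ → K (c ∷ l′)) l

unit : {C : Set} → List C → ℤ
unit [] = 1ℤ
unit (_ ∷ _) = 0ℤ

det : {R C : Set} → (R → C → ℤ) → List R → List C → ℤ
det b [] = unit
det b (r ∷ rs) = contract (b r) (det b rs)

module _ {C : Set} where

  contract-cong : ∀ {r s : C → ℤ} {K L : List C → ℤ} → (∀ c → r c ≡ s c) → (∀ l → K l ≡ L l) →
    ∀ l → contract r K l ≡ contract s L l
  contract-cong r≡s K≡L [] = refl
  contract-cong r≡s K≡L (c ∷ l) =
    cong₂ _-_ (cong₂ _*_ (r≡s c) (K≡L l)) (contract-cong r≡s (λ l′ → K≡L (c ∷ l′)) l)

  contract-≈ : ∀ {t} {r s : C → ℤ} {K L : List C → ℤ} → (∀ c → r c ≈ s c [mod t ]) → (∀ l → K l ≈ L l [mod t ]) →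
    ∀ l → contract r K l ≈ contract s L l [mod t ]
  contract-≈ r≈s K≈L [] = ≈-reflexive refl
  contract-≈ r≈s K≈L (c ∷ l) =
    ≈-+ (≈-* (r≈s c) (K≈L l)) (≈-neg (contract-≈ r≈s (λ l′ → K≈L (c ∷ l′)) l))

  -- The coefficient α on the left accommodates the isobaric relation, which gives a row only after
  -- multiplication by x_j - x_{j+1}.
  contract-linearˡ : ∀ α β γ {r s t : C → ℤ} (K : List C → ℤ) → (∀ c → α * t c ≡ β * r c + γ * s c) →
    ∀ l → α * contract t K l ≡ β * contract r K l + γ * contract s K l
  contract-linearˡ α β γ K eq [] = identity α β γ
    where
    identity : ∀ α β γ → α * 0ℤ ≡ β * 0ℤ + γ * 0ℤ
    identity = solve-∀
  contract-linearˡ α β γ {r} {s} {t} K eq (c ∷ l) = begin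
    α * (t c * K l - contract t K′ l)
      ≡⟨ id₁ α (t c) (K l) (contract t K′ l) ⟩
    α * t c * K l - α * contract t K′ l
      ≡⟨ cong₂ (λ p q → p * K l - q) (eq c) (contract-linearˡ α β γ K′ eq l) ⟩
    (β * r c + γ * s c) * K l - (β * contract r K′ l + γ * contract s K′ l)
      ≡⟨ id₂ β γ (r c) (s c) (K l) (contract r K′ l) (contract s K′ l) ⟩
    β * (r c * K l - contract r K′ l) + γ * (s c * K l - contract s K′ l) ∎
    where
    K′ : List C → ℤ
    K′ l′ = K (c ∷ l′)
    id₁ : ∀ α t k z → α * (t * k - z) ≡ α * t * k - α * z
    id₁ = solve-∀
    id₂ : ∀ β γ r s k y z → (β * r + γ * s) * k - (β * y + γ * z) ≡ β * (r * k - y) + γ * (s * k - z)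
    id₂ = solve-∀

  contract-linearʳ : ∀ α β γ (r : C → ℤ) {K L M : List C → ℤ} → (∀ l → α * M l ≡ β * K l + γ * L l) →
    ∀ l → α * contract r M l ≡ β * contract r K l + γ * contract r L l
  contract-linearʳ α β γ r eq [] = identity α β γ
    where
    identity : ∀ α β γ → α * 0ℤ ≡ β * 0ℤ + γ * 0ℤ
    identity = solve-∀
  contract-linearʳ α β γ r {K} {L} {M} eq (c ∷ l) = begin
    α * (r c * M l - contract r M′ l)
      ≡⟨ id₁ α (r c) (M l) (contract r M′ l) ⟩
    r c * (α * M l) - α * contract r M′ l
      ≡⟨ cong₂ (λ p q → r c * p - q) (eq l) (contract-linearʳ α β γ r {K′} {L′} (λ l′ → eq (c ∷ l′)) l) ⟩
    r c * (β * K l + γ * L l) - (β * contract r K′ l + γ * contract r L′ l)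
      ≡⟨ id₂ β γ (r c) (K l) (L l) (contract r K′ l) (contract r L′ l) ⟩
    β * (r c * K l - contract r K′ l) + γ * (r c * L l - contract r L′ l) ∎
    where
    K′ L′ M′ : List C → ℤ
    K′ l′ = K (c ∷ l′)
    L′ l′ = L (c ∷ l′)
    M′ l′ = M (c ∷ l′)
    id₁ : ∀ α r m z → α * (r * m - z) ≡ r * (α * m) - α * z
    id₁ = solve-∀
    id₂ : ∀ β γ r k l y z → r * (β * k + γ * l) - (β * y + γ * z) ≡ β * (r * k - y) + γ * (r * l - z)
    id₂ = solve-∀

  contract-+*ˡ : ∀ γ {r s t : C → ℤ} (K : List C → ℤ) → (∀ c → t c ≡ r c + γ * s c) →
    ∀ l → contract t K l ≡ contract r K l + γ * contract s K l
  contract-+*ˡ γ {r} {s} {t} K eq l = begin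
    contract t K l                              ≡⟨ sym (ℤₚ.*-identityˡ _) ⟩
    1ℤ * contract t K l
      ≡⟨ contract-linearˡ 1ℤ 1ℤ γ {r} {s} {t} K (λ c → trans (cong (1ℤ *_) (eq c)) (identity (r c) γ (s c))) l ⟩
    1ℤ * contract r K l + γ * contract s K l       ≡⟨ sym (identity (contract r K l) γ (contract s K l)) ⟩
    1ℤ * (contract r K l + γ * contract s K l)     ≡⟨ ℤₚ.*-identityˡ _ ⟩
    contract r K l + γ * contract s K l            ∎
    where
    identity : ∀ a γ b → 1ℤ * (a + γ * b) ≡ 1ℤ * a + γ * b
    identity = solve-∀

  contract-+*ʳ : ∀ γ (r : C → ℤ) {K L M : List C → ℤ} → (∀ l → M l ≡ K l + γ * L l) →
    ∀ l → contract r M l ≡ contract r K l + γ * contract r L l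
  contract-+*ʳ γ r {K} {L} {M} eq l = begin
    contract r M l                              ≡⟨ sym (ℤₚ.*-identityˡ _) ⟩
    1ℤ * contract r M l
      ≡⟨ contract-linearʳ 1ℤ 1ℤ γ r {K} {L} {M} (λ m → trans (cong (1ℤ *_) (eq m)) (identity (K m) γ (L m))) l ⟩
    1ℤ * contract r K l + γ * contract r L l       ≡⟨ sym (identity (contract r K l) γ (contract r L l)) ⟩
    1ℤ * (contract r K l + γ * contract r L l)     ≡⟨ ℤₚ.*-identityˡ _ ⟩
    contract r K l + γ * contract r L l            ∎
    where
    identity : ∀ a γ b → 1ℤ * (a + γ * b) ≡ 1ℤ * a + γ * b
    identity = solve-∀

  contract-0 : ∀ {P : C → Set} (r : C → ℤ) {K : List C → ℤ} → (∀ {l} → All P l → K l ≡ 0ℤ) →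
    ∀ {l} → All P l → contract r K l ≡ 0ℤ
  contract-0 r K≡0 [] = refl
  contract-0 r {K} K≡0 (p ∷ ps)
    rewrite K≡0 ps | contract-0 r (λ qs → K≡0 (p ∷ qs)) ps = cong (_- 0ℤ) (ℤₚ.*-zeroʳ (r _))

  contract-neg : ∀ (r : C → ℤ) {K L : List C → ℤ} → (∀ l → K l ≡ - L l) → ∀ l → contract r K l ≡ - contract r L l
  contract-neg r K≡-L [] = refl
  contract-neg r {K} {L} K≡-L (c ∷ l)
    rewrite K≡-L l | contract-neg r {λ l′ → K (c ∷ l′)} {λ l′ → L (c ∷ l′)} (λ l′ → K≡-L (c ∷ l′)) l =
    identity (r c) (L l) (contract r (λ l′ → L (c ∷ l′)) l)
    where
    identity : ∀ r k z → r * - k - - z ≡ - (r * k - z)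
    identity = solve-∀

  -- Interior products anticommute: after the first column is split off, the terms with r c and s c
  -- match crosswise, and the double contraction that remains is the induction hypothesis. With r =
  -- s this also kills determinants whose first two rows are equal.
  contract-anticommutes : ∀ (r s : C → ℤ) K l → contract r (contract s K) l ≡ - contract s (contract r K) l
  contract-anticommutes r s K [] = refl
  contract-anticommutes r s K (c ∷ l) = begin
    r c * S - contract r (λ l′ → s c * K l′ - contract s K′ l′) l
      ≡⟨ cong (λ z → r c * S - z) (expand r s) ⟩
    r c * S - (s c * R - contract r (contract s K′) l)
      ≡⟨ cong (λ z → r c * S - (s c * R - z)) (contract-anticommutes r s K′ l) ⟩
    r c * S - (s c * R - - contract s (contract r K′) l)
      ≡⟨ identity (r c * S) (s c * R) (contract s (contract r K′) l) ⟩
    - (s c * R - (r c * S - contract s (contract r K′) l))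
      ≡⟨ cong (λ z → - (s c * R - z)) (sym (expand s r)) ⟩
    - (s c * R - contract s (λ l′ → r c * K l′ - contract r K′ l′) l) ∎
    where
    K′ : List C → ℤ
    K′ l′ = K (c ∷ l′)
    R S : ℤ
    R = contract r K l
    S = contract s K l
    expand : ∀ (r s : C → ℤ) →
      contract r (λ l′ → s c * K l′ - contract s K′ l′) l ≡ s c * contract r K l - contract r (contract s K′) l
    expand r s = begin
      contract r (λ l′ → s c * K l′ - contract s K′ l′) l     ≡⟨ sym (ℤₚ.*-identityˡ _) ⟩
      1ℤ * contract r (λ l′ → s c * K l′ - contract s K′ l′) l
        ≡⟨ contract-linearʳ 1ℤ (s c) (- 1ℤ) r {K} {contract s K′} (λ l′ → id₁ (s c) (K l′) (contract s K′ l′)) l ⟩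
      s c * contract r K l + - 1ℤ * contract r (contract s K′) l
        ≡⟨ id₂ (s c) (contract r K l) (contract r (contract s K′) l) ⟩
      s c * contract r K l - contract r (contract s K′) l     ∎
      where
      id₁ : ∀ s k z → 1ℤ * (s * k - z) ≡ s * k + - 1ℤ * z
      id₁ = solve-∀
      id₂ : ∀ s k z → s * k + - 1ℤ * z ≡ s * k - z
      id₂ = solve-∀
    identity : ∀ p q z → p - (q - - z) ≡ - (q - (p - z))
    identity = solve-∀

  contract-vanishing : ∀ {r : C → ℤ} (K : List C → ℤ) {l} → All (λ c → r c ≡ 0ℤ) l → contract r K l ≡ 0ℤ
  contract-vanishing K [] = refl
  contract-vanishing {r} K {c ∷ l} (r≡0 ∷ rs≡0)
    rewrite r≡0 | contract-vanishing {r} (λ l′ → K (c ∷ l′)) rs≡0 = refl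

≡-⇒≡0 : ∀ {z} → z ≡ - z → z ≡ 0ℤ
≡-⇒≡0 {+ zero} eq = refl
≡-⇒≡0 {+ suc n} ()
≡-⇒≡0 {ℤ.negsuc n} ()

module _ {R C : Set} (b : R → C → ℤ) where

  ColumnLinear : (List C → ℤ) → Set
  ColumnLinear K = ∀ l {c d d′} y l′ → (∀ r → b r d′ ≡ b r d + y * b r c) →
    K (l ++ d′ ∷ l′) ≡ K (l ++ d ∷ l′) + y * K (l ++ c ∷ l′)

  ColumnAlternating : (List C → ℤ) → Set
  ColumnAlternating K = ∀ l c d l′ → K (l ++ c ∷ d ∷ l′) ≡ - K (l ++ d ∷ c ∷ l′)

  contract-columnLinear : ∀ r {K} → ColumnLinear K → ColumnLinear (contract (b r) K)
  contract-columnLinear r {K} lin [] {c} {d} {d′} y l′ eq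
    rewrite eq r
          | contract-+*ʳ y (b r) {λ m → K (d ∷ m)} {λ m → K (c ∷ m)} {λ m → K (d′ ∷ m)} (λ m → lin [] y m eq) l′ =
    identity (b r d) (b r c) y (K l′) (contract (b r) (λ m → K (d ∷ m)) l′) (contract (b r) (λ m → K (c ∷ m)) l′)
    where
    identity : ∀ d c y k p q → (d + y * c) * k - (p + y * q) ≡ (d * k - p) + y * (c * k - q)
    identity = solve-∀
  contract-columnLinear r {K} lin (e ∷ l) {c} {d} {d′} y l′ eq
    rewrite lin l y l′ eq | contract-columnLinear r {λ m → K (e ∷ m)} (λ m → lin (e ∷ m)) l y l′ eq =
    identity (b r e) y (K (l ++ d ∷ l′)) (K (l ++ c ∷ l′))
      (contract (b r) (λ m → K (e ∷ m)) (l ++ d ∷ l′)) (contract (b r) (λ m → K (e ∷ m)) (l ++ c ∷ l′))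
    where
    identity : ∀ e y j k p q → e * (j + y * k) - (p + y * q) ≡ (e * j - p) + y * (e * k - q)
    identity = solve-∀

  contract-columnAlternating : ∀ r {K} → ColumnAlternating K → ColumnAlternating (contract (b r) K)
  contract-columnAlternating r {K} alt [] c d l′
    rewrite contract-neg (b r) {λ m → K (c ∷ d ∷ m)} {λ m → K (d ∷ c ∷ m)} (alt [] c d) l′ =
    identity (b r c * K (d ∷ l′)) (b r d * K (c ∷ l′)) (contract (b r) (λ m → K (d ∷ c ∷ m)) l′)
    where
    identity : ∀ p q z → p - (q - - z) ≡ - (q - (p - z))
    identity = solve-∀
  contract-columnAlternating r {K} alt (e ∷ l) c d l′
    rewrite alt l c d l′ | contract-columnAlternating r {λ m → K (e ∷ m)} (λ m → alt (e ∷ m)) l c d l′ =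
    identity (b r e) (K (l ++ d ∷ c ∷ l′)) (contract (b r) (λ m → K (e ∷ m)) (l ++ d ∷ c ∷ l′))
    where
    identity : ∀ e k z → e * - k - - z ≡ - (e * k - z)
    identity = solve-∀

  det-columnLinear : ∀ rs → ColumnLinear (det b rs)
  det-columnLinear [] [] y l′ eq = sym (cong (_+_ 0ℤ) (ℤₚ.*-zeroʳ y))
  det-columnLinear [] (_ ∷ _) y l′ eq = sym (cong (_+_ 0ℤ) (ℤₚ.*-zeroʳ y))
  det-columnLinear (r ∷ rs) = contract-columnLinear r (det-columnLinear rs)

  det-columnAlternating : ∀ rs → ColumnAlternating (det b rs)
  det-columnAlternating [] [] c d l′ = refl
  det-columnAlternating [] (_ ∷ _) c d l′ = refl
  det-columnAlternating (r ∷ rs) = contract-columnAlternating r (det-columnAlternating rs)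

  addColumn : ∀ {K} → ColumnLinear K → ColumnAlternating K → ∀ {c d d′} y l →
    (∀ r → b r d′ ≡ b r d + y * b r c) → K (c ∷ d′ ∷ l) ≡ K (c ∷ d ∷ l)
  addColumn {K} lin alt {c} {d} {d′} y l eq = begin
    K (c ∷ d′ ∷ l)                          ≡⟨ lin (c ∷ []) y l eq ⟩
    K (c ∷ d ∷ l) + y * K (c ∷ c ∷ l)       ≡⟨ cong (λ z → K (c ∷ d ∷ l) + y * z) (≡-⇒≡0 (alt [] c c l)) ⟩
    K (c ∷ d ∷ l) + y * 0ℤ                  ≡⟨ cong (_+_ (K (c ∷ d ∷ l))) (ℤₚ.*-zeroʳ y) ⟩
    K (c ∷ d ∷ l) + 0ℤ                      ≡⟨ ℤₚ.+-identityʳ _ ⟩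
    K (c ∷ d ∷ l)                           ∎

  -- The replacement goes from right to left, so that each column is reduced while its left
  -- neighbour is still the original one.
  differenceColumns : ∀ {K} → ColumnLinear K → ColumnAlternating K → ∀ (col diff : ℕ → C) y →
    (∀ r j → b r (diff j) ≡ b r (col (suc j)) + y * b r (col j)) →
    ∀ n s → K (col s ∷ map col (range (suc s) n)) ≡ K (col s ∷ map diff (range s n))
  differenceColumns lin alt col diff y eq zero s = refl
  differenceColumns {K} lin alt col diff y eq (suc n) s =
    trans (differenceColumns {λ l → K (col s ∷ l)} (λ l → lin (col s ∷ l)) (λ l → alt (col s ∷ l)) col diff y eq n (suc s))
          (sym (addColumn {K} lin alt y (map diff (range (suc s) n)) (λ r → eq r s)))

contract-map : ∀ {B C : Set} (r : C → ℤ) (K : List C → ℤ) (g : B → C) l →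
  contract r K (map g l) ≡ contract (λ c → r (g c)) (λ l′ → K (map g l′)) l
contract-map r K g [] = refl
contract-map r K g (c ∷ l) = cong (λ z → r (g c) * K (map g l) - z) (contract-map r (λ l′ → K (g c ∷ l′)) g l)

det-mapColumns : ∀ {R B C : Set} (b : R → C → ℤ) (g : B → C) rs l →
  det b rs (map g l) ≡ det (λ r c → b r (g c)) rs l
det-mapColumns b g [] [] = refl
det-mapColumns b g [] (_ ∷ _) = refl
det-mapColumns b g (r ∷ rs) l =
  trans (contract-map (b r) (det b rs) g l) (contract-cong (λ _ → refl) (det-mapColumns b g rs) l)

det-mapRows : ∀ {Q R C : Set} (b : R → C → ℤ) (f : Q → R) rs l →
  det b (map f rs) l ≡ det (λ r c → b (f r) c) rs l
det-mapRows b f [] l = refl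
det-mapRows b f (r ∷ rs) l = contract-cong (λ _ → refl) (det-mapRows b f rs) l

det-cong : ∀ {R C : Set} {b b′ : R → C → ℤ} {rs} → All (λ r → ∀ c → b r c ≡ b′ r c) rs →
  ∀ l → det b rs l ≡ det b′ rs l
det-cong [] l = refl
det-cong (eq ∷ eqs) l = contract-cong eq (det-cong eqs) l

det-≈ : ∀ {R C : Set} {b b′ : R → C → ℤ} {t} → (∀ r c → b r c ≈ b′ r c [mod t ]) →
  ∀ rs l → det b rs l ≈ det b′ rs l [mod t ]
det-≈ eq [] l = ≈-reflexive refl
det-≈ eq (r ∷ rs) l = contract-≈ (eq r) (det-≈ eq rs) l

range-≥ : ∀ s n → All (s ≤_) (range s n)
range-≥ s zero = []
range-≥ s (suc n) = ℕₚ.≤-refl ∷ All.map ℕₚ.<⇒≤ (range-≥ (suc s) n)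

-- Subtracting y times each column from the next one clears the geometric row g except for its first entry.
det-geometricRow : ∀ {R : Set} (b : R → ℕ → ℤ) y g {s} → (∀ {j} → s ≤ j → b g (suc j) ≡ y * b g j) → ∀ rs n →
  det b (g ∷ rs) (range s (suc n)) ≡ b g s * det (λ r j → b r (suc j) - y * b r j) rs (range s n)
det-geometricRow {R} b y g {s} geo rs n = begin
  det b (g ∷ rs) (range s (suc n))
    -- Columns become functions on the rows, because a combination of two indexed columns need not
    -- be an indexed column.
    ≡⟨ sym (det-mapColumns apply col (g ∷ rs) (range s (suc n))) ⟩
  det apply (g ∷ rs) (col s ∷ map col (range (suc s) n))
    ≡⟨ differenceColumns apply {det apply (g ∷ rs)} (det-columnLinear apply (g ∷ rs)) (det-columnAlternating apply (g ∷ rs))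
         col diff (- y) (λ r j → cong (_+_ (b r (suc j))) (ℤₚ.neg-distribˡ-* y (b r j))) n s ⟩
  b g s * det apply rs (map diff (range s n)) - contract (apply g) (λ l → det apply rs (col s ∷ l)) (map diff (range s n))
    ≡⟨ cong₂ (λ p q → b g s * p - q) (det-mapColumns apply diff rs (range s n))
         (contract-vanishing (λ l → det apply rs (col s ∷ l)) (map⁺ (All.map killed (range-≥ s n)))) ⟩
  b g s * det (λ r j → diff j r) rs (range s n) - 0ℤ
    ≡⟨ ℤₚ.+-identityʳ _ ⟩
  b g s * det (λ r j → diff j r) rs (range s n) ∎
  where
  apply : R → (R → ℤ) → ℤ
  apply r c = c r
  col diff : ℕ → R → ℤ
  col j r = b r j
  diff j r = b r (suc j) - y * b r j
  killed : ∀ {j} → s ≤ j → diff j g ≡ 0ℤ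
  killed {j} s≤j rewrite geo s≤j = ℤₚ.+-inverseʳ (y * b g j)

-- Permuted rows and columns, block triangular determinants

SameUpToSign : {C : Set} → (List C → ℤ) → (List C → ℤ) → Set
SameUpToSign K L = (∀ l → K l ≡ L l) ⊎ (∀ l → K l ≡ - L l)

contract-sameUpToSign : ∀ {C : Set} (r : C → ℤ) {K L} → SameUpToSign K L → SameUpToSign (contract r K) (contract r L)
contract-sameUpToSign r (inj₁ eq) = inj₁ (contract-cong (λ _ → refl) eq)
contract-sameUpToSign r (inj₂ eq) = inj₂ (contract-neg r eq)

sameUpToSign-trans : ∀ {C : Set} {K L M : List C → ℤ} → SameUpToSign K L → SameUpToSign L M → SameUpToSign K M
sameUpToSign-trans (inj₁ p) (inj₁ q) = inj₁ λ l → trans (p l) (q l)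
sameUpToSign-trans (inj₁ p) (inj₂ q) = inj₂ λ l → trans (p l) (q l)
sameUpToSign-trans (inj₂ p) (inj₁ q) = inj₂ λ l → trans (p l) (cong -_ (q l))
sameUpToSign-trans (inj₂ p) (inj₂ q) = inj₁ λ l → trans (p l) (trans (cong -_ (q l)) (ℤₚ.neg-involutive _))

-- The sign must be the same for all column lists, since `contract` evaluates the inner form at many
-- of them.
det-permuteRows : ∀ {R C : Set} (b : R → C → ℤ) {rs rs′} → rs ↭ rs′ → SameUpToSign (det b rs) (det b rs′)
det-permuteRows b ↭-refl′ = inj₁ (λ _ → refl)
det-permuteRows b (prep r p) = contract-sameUpToSign (b r) (det-permuteRows b p)
det-permuteRows b (swap r s p) =
  sameUpToSign-trans (inj₂ (contract-anticommutes (b r) (b s) _))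
    (contract-sameUpToSign (b s) (contract-sameUpToSign (b r) (det-permuteRows b p)))
det-permuteRows b (↭-trans′ p q) = sameUpToSign-trans (det-permuteRows b p) (det-permuteRows b q)

∣∣-permuteColumns : ∀ {R C : Set} (b : R → C → ℤ) (K : List C → ℤ) → ColumnAlternating b K → ∀ {l l′} → l ↭ l′ → ∣ K l ∣ ≡ ∣ K l′ ∣
∣∣-permuteColumns b K alt ↭-refl′ = refl
∣∣-permuteColumns b K alt (prep c p) = ∣∣-permuteColumns b (λ l → K (c ∷ l)) (λ l → alt (c ∷ l)) p
∣∣-permuteColumns b K alt (swap {l} {l′} c d p) =
  trans (trans (cong ∣_∣ (alt [] c d l)) (ℤₚ.∣-i∣≡∣i∣ (K (d ∷ c ∷ l))))
        (∣∣-permuteColumns b (λ m → K (d ∷ c ∷ m)) (λ m → alt (d ∷ c ∷ m)) p)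
∣∣-permuteColumns b K alt (↭-trans′ p q) = trans (∣∣-permuteColumns b K alt p) (∣∣-permuteColumns b K alt q)

∣det∣-permute : ∀ {R C : Set} (b : R → C → ℤ) {rs rs′ l l′} → rs ↭ rs′ → l ↭ l′ → ∣ det b rs l ∣ ≡ ∣ det b rs′ l′ ∣
∣det∣-permute b {rs} {rs′} {l} {l′} p q =
  trans (upToSign (det-permuteRows b p)) (∣∣-permuteColumns b (det b rs′) (det-columnAlternating b rs′) q)
  where
  upToSign : SameUpToSign (det b rs) (det b rs′) → ∣ det b rs l ∣ ≡ ∣ det b rs′ l ∣
  upToSign (inj₁ eq) = cong ∣_∣ (eq l)
  upToSign (inj₂ eq) = trans (cong ∣_∣ (eq l)) (ℤₚ.∣-i∣≡∣i∣ (det b rs′ l))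

contract-++ : ∀ {C : Set} {r : C → ℤ} (K : List C → ℤ) l {l′} → All (λ c → r c ≡ 0ℤ) l′ →
  contract r K (l ++ l′) ≡ contract r (λ m → K (m ++ l′)) l
contract-++ K [] r≡0 = contract-vanishing K r≡0
contract-++ {r = r} K (c ∷ l) {l′} r≡0 = cong (λ z → r c * K (l ++ l′) - z) (contract-++ (λ m → K (c ∷ m)) l r≡0)

contract-cong-length : ∀ {C : Set} (r : C → ℤ) {K L : List C → ℤ} y n → (∀ l → length l ≡ n → K l ≡ L l * y) →
  ∀ l → length l ≡ suc n → contract r K l ≡ contract r L l * y
contract-cong-length r {K} {L} y zero eq (c ∷ []) _ rewrite eq [] refl = identity (r c) (L []) y
  where
  identity : ∀ p k y → p * (k * y) - 0ℤ ≡ (p * k - 0ℤ) * y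
  identity = solve-∀
contract-cong-length r {K} {L} y (suc n) eq (c ∷ l) len
  rewrite eq l (ℕₚ.suc-injective len)
        | contract-cong-length r {λ m → K (c ∷ m)} {λ m → L (c ∷ m)} y n (λ m len′ → eq (c ∷ m) (cong suc len′))
            l (ℕₚ.suc-injective len) =
  identity (r c) (L l) y (contract r (λ m → L (c ∷ m)) l)
  where
  identity : ∀ p k y z → p * (k * y) - z * y ≡ (p * k - z) * y
  identity = solve-∀

-- Expansion along `rs` can only use columns of `l`. By the length condition these are used up
-- exactly when `rs` is, which leaves `rs′` with `l′`.
det-block : ∀ {R C : Set} (b : R → C → ℤ) rs rs′ {l′} → All (λ r → All (λ c → b r c ≡ 0ℤ) l′) rs →
  ∀ l → length l ≡ length rs → det b (rs ++ rs′) (l ++ l′) ≡ det b rs l * det b rs′ l′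
det-block b [] rs′ [] [] refl = sym (ℤₚ.*-identityˡ _)
det-block b (r ∷ rs) rs′ {l′} (r≡0 ∷ rs≡0) l len =
  trans (contract-++ (det b (rs ++ rs′)) l r≡0)
        (contract-cong-length (b r) (det b rs′ l′) (length rs) (det-block b rs rs′ rs≡0) l len)

-- Flagged complete homogeneous determinants

-- Coefficients of s(t) / (1 − y t).
geometric : ℤ → (ℕ → ℤ) → ℕ → ℤ
geometric y s zero = s zero
geometric y s (suc d) = s (suc d) + y * geometric y s d

monomial : ℕ → ℕ → ℤ
monomial zero zero = 1ℤ
monomial zero (suc d) = 0ℤ
monomial (suc k) zero = 0ℤ
monomial (suc k) (suc d) = monomial k d

-- h x k f d is the complete homogeneous polynomial of degree d − k in x_0, …, x_{f−1} (and 0 if d < k).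
h : Point → ℕ → ℕ → ℕ → ℤ
h x k zero = monomial k
h x k (suc f) = geometric (x 0) (h (tail x) k f)

geometric-cong : ∀ y {r s} → (∀ d → r d ≡ s d) → ∀ d → geometric y r d ≡ geometric y s d
geometric-cong y r≡s zero = r≡s zero
geometric-cong y r≡s (suc d) = cong₂ (λ p q → p + y * q) (r≡s (suc d)) (geometric-cong y r≡s d)

geometric-linear : ∀ y α β γ {r s t} → (∀ d → α * t d ≡ β * r d + γ * s d) →
  ∀ d → α * geometric y t d ≡ β * geometric y r d + γ * geometric y s d
geometric-linear y α β γ eq zero = eq zero
geometric-linear y α β γ {r} {s} {t} eq (suc d) = begin
  α * (t (suc d) + y * Q)                                   ≡⟨ id₁ α (t (suc d)) y Q ⟩
  α * t (suc d) + y * (α * Q)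
    ≡⟨ cong₂ (λ p q → p + y * q) (eq (suc d)) (geometric-linear y α β γ {r} {s} {t} eq d) ⟩
  (β * r (suc d) + γ * s (suc d)) + y * (β * R + γ * S)     ≡⟨ id₂ β γ (r (suc d)) (s (suc d)) y R S ⟩
  β * (r (suc d) + y * R) + γ * (s (suc d) + y * S)         ∎
  where
  Q R S : ℤ
  R = geometric y r d
  S = geometric y s d
  Q = geometric y t d
  id₁ : ∀ α a y b → α * (a + y * b) ≡ α * a + y * (α * b)
  id₁ = solve-∀
  id₂ : ∀ β γ r s y p q → (β * r + γ * s) + y * (β * p + γ * q) ≡ β * (r + y * p) + γ * (s + y * q)
  id₂ = solve-∀

geometric-+* : ∀ y γ {r s t} → (∀ d → t d ≡ r d + γ * s d) → ∀ d → geometric y t d ≡ geometric y r d + γ * geometric y s d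
geometric-+* y γ {r} {s} {t} eq d = begin
  geometric y t d                                  ≡⟨ sym (ℤₚ.*-identityˡ _) ⟩
  1ℤ * geometric y t d
    ≡⟨ geometric-linear y 1ℤ 1ℤ γ {r} {s} {t} (λ d′ → trans (cong (1ℤ *_) (eq d′)) (identity (r d′) γ (s d′))) d ⟩
  1ℤ * geometric y r d + γ * geometric y s d       ≡⟨ sym (identity (geometric y r d) γ (geometric y s d)) ⟩
  1ℤ * (geometric y r d + γ * geometric y s d)     ≡⟨ ℤₚ.*-identityˡ _ ⟩
  geometric y r d + γ * geometric y s d            ∎
  where
  identity : ∀ r γ s → 1ℤ * (r + γ * s) ≡ 1ℤ * r + γ * s
  identity = solve-∀

-- Partial fractions: (u - v) / ((1 - ut)(1 - vt)) = u / (1 - ut) - v / (1 - vt), multiplied by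
-- s(t).
geometric-isobaric : ∀ u v s d →
  (u - v) * geometric u (geometric v s) d ≡ u * geometric u s d + - v * geometric v s d
geometric-isobaric u v s zero = identity u v (s 0)
  where
  identity : ∀ u v a → (u - v) * a ≡ u * a + - v * a
  identity = solve-∀
geometric-isobaric u v s (suc d) = begin
  (u - v) * (s (suc d) + v * V + u * W)                       ≡⟨ id₁ u v (s (suc d)) V W ⟩
  (u - v) * (s (suc d) + v * V) + u * ((u - v) * W)
    ≡⟨ cong (λ z → (u - v) * (s (suc d) + v * V) + u * z) (geometric-isobaric u v s d) ⟩
  (u - v) * (s (suc d) + v * V) + u * (u * U + - v * V)       ≡⟨ id₂ u v (s (suc d)) U V ⟩
  u * (s (suc d) + u * U) + - v * (s (suc d) + v * V)         ∎
  where
  U V W : ℤ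
  U = geometric u s d
  V = geometric v s d
  W = geometric u (geometric v s) d
  id₁ : ∀ u v a p w → (u - v) * (a + v * p + u * w) ≡ (u - v) * (a + v * p) + u * ((u - v) * w)
  id₁ = solve-∀
  id₂ : ∀ u v a o p → (u - v) * (a + v * p) + u * (u * o + - v * p) ≡ u * (a + u * o) + - v * (a + v * p)
  id₂ = solve-∀

geometric-commutes : ∀ u v s d → geometric u (geometric v s) d ≡ geometric v (geometric u s) d
geometric-commutes u v s zero = refl
geometric-commutes u v s (suc d) = begin
  -- Splitting u W as (u - v) W + v W leaves the first part to partial fractions and the second to
  -- induction.
  s (suc d) + v * V + u * W                          ≡⟨ id₁ u v (s (suc d)) V W ⟩
  s (suc d) + v * V + (u - v) * W + v * W
    ≡⟨ cong₂ (λ p q → s (suc d) + v * V + p + v * q) (geometric-isobaric u v s d) (geometric-commutes u v s d) ⟩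
  s (suc d) + v * V + (u * U + - v * V) + v * W′     ≡⟨ id₂ u v (s (suc d)) U V W′ ⟩
  s (suc d) + u * U + v * W′                         ∎
  where
  U V W W′ : ℤ
  U = geometric u s d
  V = geometric v s d
  W = geometric u (geometric v s) d
  W′ = geometric v (geometric u s) d
  id₁ : ∀ u v a p w → a + v * p + u * w ≡ a + v * p + (u - v) * w + v * w
  id₁ = solve-∀
  id₂ : ∀ u v a o p w → a + v * p + (u * o + - v * p) + v * w ≡ a + u * o + v * w
  id₂ = solve-∀

geometric-≈ : ∀ {t u v r s} → u ≈ v [mod t ] → (∀ d → r d ≈ s d [mod t ]) →
  ∀ d → geometric u r d ≈ geometric v s d [mod t ]
geometric-≈ u≈v r≈s zero = r≈s zero
geometric-≈ u≈v r≈s (suc d) = ≈-+ (r≈s (suc d)) (≈-* u≈v (geometric-≈ u≈v r≈s d))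

h-congruent : ∀ k f d → Congruent (λ x → h x k f d)
h-congruent k zero d t x≈y = ≈-reflexive refl
h-congruent k (suc f) d t x≈y = geometric-≈ (x≈y 0) (λ d′ → h-congruent k f d′ t (λ i → x≈y (suc i))) d

-- The isobaric operator raises the flag from j + 1 to j + 2. For j = 0 this is partial fractions;
-- otherwise the factor 1 / (1 - x_0 t) is common to all three terms and passes through by
-- linearity.
h-isobaric : ∀ j x k d →
  (x j - x (suc j)) * h x k (suc (suc j)) d ≡ x j * h x k (suc j) d + - x (suc j) * h (transpose j x) k (suc j) d
h-isobaric zero x k = geometric-isobaric (x 0) (x 1) (monomial k)
h-isobaric (suc j) x k = geometric-linear (x 0) (x (suc j) - x (suc (suc j))) (x (suc j)) (- x (suc (suc j)))
  {h (tail x) k (suc j)} {h (transpose j (tail x)) k (suc j)} {h (tail x) k (suc (suc j))} (h-isobaric j (tail x) k)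

-- The two cases in which h x k f d is symmetric in x_j and x_{j+1}.
Symmetric : ℕ → ℕ → Set
Symmetric j f = f ≤ j ⊎ suc (suc j) ≤ f

h-transpose : ∀ {j f} → Symmetric j f → ∀ x k d → h (transpose j x) k f d ≡ h x k f d
h-transpose {zero} (inj₁ z≤n) x k d = refl
h-transpose {zero} (inj₂ (s≤s (s≤s _))) x k d = geometric-commutes (x 1) (x 0) _ d
h-transpose {suc j} {zero} _ x k d = refl
h-transpose {suc j} {suc f} (inj₁ (s≤s f≤j)) x k d = geometric-cong (x 0) (h-transpose (inj₁ f≤j) (tail x) k) d
h-transpose {suc j} {suc f} (inj₂ (s≤s j<f)) x k d = geometric-cong (x 0) (h-transpose (inj₂ j<f) (tail x) k) d

h-zero : ∀ x k f → h x (suc k) f 0 ≡ 0ℤ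
h-zero x k zero = refl
h-zero x k (suc f) = h-zero (tail x) k f

h-suc : ∀ x k f d → h x (suc k) f (suc d) ≡ h x k f d
h-suc x k zero d = refl
h-suc x k (suc f) zero rewrite h-zero (tail x) k f | ℤₚ.*-zeroʳ (x 0) | h-suc (tail x) k f 0 = ℤₚ.+-identityʳ _
h-suc x k (suc f) (suc d) = cong₂ (λ p q → p + x 0 * q) (h-suc (tail x) k f (suc d)) (h-suc x k (suc f) d)

-- The generating function times 1 - x_f t loses its last factor; raising k by one is multiplication
-- by t. This identity drives both the row operation at (1, -1, ...) and the positivity argument.
h-lastVariable : ∀ x k f d → h x k (suc f) d ≡ h x k f d + x f * h x (suc k) (suc f) d
h-lastVariable x k zero zero = sym (trans (cong (_+_ (monomial k 0)) (ℤₚ.*-zeroʳ (x 0))) (ℤₚ.+-identityʳ _))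
h-lastVariable x k zero (suc d) = cong (λ z → monomial k (suc d) + x 0 * z) (sym (h-suc x k 1 d))
h-lastVariable x k (suc f) d = geometric-+* (x 0) (x (suc f)) {h (tail x) k f} (h-lastVariable (tail x) k f) d

monomial-< : ∀ {k d} → k < d → monomial k d ≡ 0ℤ
monomial-< {zero} {suc d} _ = refl
monomial-< {suc k} {suc d} (s≤s k<d) = monomial-< k<d

h-oneVariable-suc : ∀ x {k d} → k ≤ d → h x k 1 (suc d) ≡ x 0 * h x k 1 d
h-oneVariable-suc x k≤d = trans (cong₂ _+_ (monomial-< (s≤s k≤d)) refl) (ℤₚ.+-identityˡ _)

h-oneVariable : ∀ x e k → h x k 1 (e +ℕ k) ≡ pow (x 0) e
h-oneVariable x zero zero = refl
h-oneVariable x zero (suc k) = trans (h-suc x k 1 k) (h-oneVariable x zero k)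
h-oneVariable x (suc e) k = trans (h-oneVariable-suc x (ℕₚ.m≤n+m k e)) (cong (x 0 *_) (h-oneVariable x e k))

entry : Point → ℕ × ℕ → ℕ → ℤ
entry x r d = h x (proj₁ r) (proj₂ r) d

flagged : ℕ → ℕ → List (ℕ × ℕ) → Point → ℤ
flagged D n rs x = det (entry x) rs (range D n)

flagged-congruent : ∀ D n rs → Congruent (flagged D n rs)
flagged-congruent D n rs t x≈y = det-≈ (λ r d → h-congruent (proj₁ r) (proj₂ r) d t x≈y) rs (range D n)

SymmetricRow : ℕ → ℕ × ℕ → Set
SymmetricRow j r = Symmetric j (proj₂ r)

det-transpose : ∀ {j rs} → All (SymmetricRow j) rs → ∀ x l → det (entry (transpose j x)) rs l ≡ det (entry x) rs l
det-transpose {j} sym-rs x = det-cong (All.map {P = SymmetricRow j} (λ {r} s d → h-transpose s x (proj₁ r) d) sym-rs)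

flagged-transpose : ∀ {j} D n {rs} → All (SymmetricRow j) rs → ∀ x → flagged D n rs (transpose j x) ≡ flagged D n rs x
flagged-transpose D n sym-rs x = det-transpose sym-rs x (range D n)

-- Every row but the first is symmetric in x_j and x_{j+1}, so the operator acts on the first row
-- alone, by linearity.
det-isobaric : ∀ {j k rs} → All (SymmetricRow j) rs → ∀ x l →
  (x j - x (suc j)) * det (entry x) ((k , suc (suc j)) ∷ rs) l
    ≡ x j * det (entry x) ((k , suc j) ∷ rs) l + - x (suc j) * det (entry (transpose j x)) ((k , suc j) ∷ rs) l
det-isobaric {j} {k} {rs} sym-rs x l = trans
  (contract-linearˡ (x j - x (suc j)) (x j) (- x (suc j)) (det (entry x) rs) (h-isobaric j x k) l)
  (cong (λ z → x j * det (entry x) ((k , suc j) ∷ rs) l + - x (suc j) * z)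
        (contract-cong (λ _ → refl) (λ m → sym (det-transpose sym-rs x m)) l))

plus-neg : ∀ u v a b → u * a + - v * b ≡ u * a - v * b
plus-neg u v a b = cong (_+_ (u * a)) (sym (ℤₚ.neg-distribˡ-* v b))

flagged-isobaric : ∀ {j k rs} D n → All (SymmetricRow j) rs →
  IsIsobaric j (flagged D n ((k , suc j) ∷ rs)) (flagged D n ((k , suc (suc j)) ∷ rs))
flagged-isobaric {j} D n sym-rs x =
  trans (det-isobaric sym-rs x (range D n)) (plus-neg (x j) (x (suc j)) _ _)

flagged-isobaric₂ : ∀ {j k r rs} D n → SymmetricRow j r → All (SymmetricRow j) rs →
  IsIsobaric j (flagged D n (r ∷ (k , suc j) ∷ rs)) (flagged D n (r ∷ (k , suc (suc j)) ∷ rs))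
flagged-isobaric₂ {j} {k} {r} {rs} D n sym-r sym-rs x = begin
  (x j - x (suc j)) * flagged D n (r ∷ (k , suc (suc j)) ∷ rs) x
    ≡⟨ contract-linearʳ (x j - x (suc j)) (x j) (- x (suc j)) (entry x r) (det-isobaric {k = k} sym-rs x) (range D n) ⟩
  x j * flagged D n (r ∷ (k , suc j) ∷ rs) x + - x (suc j) * contract (entry x r) (det (entry y) ((k , suc j) ∷ rs)) (range D n)
    ≡⟨ cong (λ z → x j * flagged D n (r ∷ (k , suc j) ∷ rs) x + - x (suc j) * z)
         (contract-cong (λ d → sym (h-transpose sym-r x (proj₁ r) d)) (λ _ → refl) (range D n)) ⟩
  x j * flagged D n (r ∷ (k , suc j) ∷ rs) x + - x (suc j) * flagged D n (r ∷ (k , suc j) ∷ rs) y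
    ≡⟨ plus-neg (x j) (x (suc j)) _ _ ⟩
  x j * flagged D n (r ∷ (k , suc j) ∷ rs) x - x (suc j) * flagged D n (r ∷ (k , suc j) ∷ rs) y ∎
  where
  y : Point
  y = transpose j x

-- The effect of bordering on an old row. The flag takes in the new variable x_0, and old column d
-- becomes column d + 2: the range starts one later, and its first column is the pivot.
lift : ℕ × ℕ → ℕ × ℕ
lift r = suc (suc (proj₁ r)) , suc (proj₂ r)

map-suc-range : ∀ s n → map suc (range s n) ≡ range (suc s) n
map-suc-range s zero = refl
map-suc-range s (suc n) = cong (suc s ∷_) (map-suc-range (suc s) n)

h-lift : ∀ x k f d → h x (suc (suc k)) (suc f) (suc (suc d)) - x 0 * h x (suc (suc k)) (suc f) (suc d) ≡ h (tail x) k f d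
h-lift x k f d = begin
  h (tail x) (suc (suc k)) f (suc (suc d)) + z - z   ≡⟨ identity _ z ⟩
  h (tail x) (suc (suc k)) f (suc (suc d))           ≡⟨ h-suc (tail x) (suc k) f (suc d) ⟩
  h (tail x) (suc k) f (suc d)                       ≡⟨ h-suc (tail x) k f d ⟩
  h (tail x) k f d                                   ∎
  where
  z : ℤ
  z = x 0 * h x (suc (suc k)) (suc f) (suc d)
  identity : ∀ a z → a + z - z ≡ a
  identity = solve-∀

-- Read from right to left: the row (k, 1) consists of powers of x_0, and column differences clear
-- it up to its pivot, which is x_0^e because e + k is the first column. The same differences remove
-- the factor 1 / (1 - x_0 t) from the other rows.
flagged-border : ∀ e k {D} n rs → e +ℕ k ≡ suc D → ∀ x →
  pow (x 0) e * flagged D n rs (tail x) ≡ flagged (suc D) (suc n) ((k , 1) ∷ map lift rs) x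
flagged-border e k {D} n rs e+k x = sym (begin
  flagged (suc D) (suc n) ((k , 1) ∷ map lift rs) x
    ≡⟨ det-geometricRow (entry x) (x 0) (k , 1) (λ D<j → h-oneVariable-suc x (ℕₚ.≤-trans k≤sD D<j)) (map lift rs) n ⟩
  h x k 1 (suc D) * det differences (map lift rs) (range (suc D) n)
    ≡⟨ cong₂ _*_ (trans (cong (h x k 1) (sym e+k)) (h-oneVariable x e k)) (begin
         det differences (map lift rs) (range (suc D) n)
           ≡⟨ det-mapRows differences lift rs _ ⟩
         det (λ r → differences (lift r)) rs (range (suc D) n)
           ≡⟨ cong (det _ rs) (sym (map-suc-range D n)) ⟩
         det (λ r → differences (lift r)) rs (map suc (range D n))
           ≡⟨ det-mapColumns _ suc rs (range D n) ⟩
         det (λ r d → differences (lift r) (suc d)) rs (range D n)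
           ≡⟨ det-cong (All.universal (λ r → h-lift x (proj₁ r) (proj₂ r)) rs) (range D n) ⟩
         det (entry (tail x)) rs (range D n) ∎) ⟩
  pow (x 0) e * flagged D n rs (tail x) ∎)
  where
  differences : ℕ × ℕ → ℕ → ℤ
  differences r d = entry x r (suc d) - x 0 * entry x r d
  k≤sD : k ≤ suc D
  k≤sD = subst (k ≤_) e+k (ℕₚ.m≤n+m k e)

-- Schubert polynomials of 1ᵃ × w₀(p) and 1ᵃ × w̃₀(N)

IsSchubert-descending : ∀ w → firstAscent w ≡ nothing → IsSchubert w (λ x → evalMono x (stair (length w)))
IsSchubert-descending w desc fuel _ x rewrite schubertAux-nothing fuel w desc =
  trans (ℤₚ.+-identityʳ _) (ℤₚ.*-identityˡ _)

IsSchubert-w0 : ∀ a → IsSchubert (w0 a ++ []) (λ x → evalMono x (stair a) * 1ℤ)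
IsSchubert-w0 zero = IsSchubert-descending [] refl
IsSchubert-w0 (suc a) = subst (λ w → IsSchubert w (λ x → evalMono x (stair (suc a)) * 1ℤ)) (sym (++-identityʳ (w0 (suc a))))
  (IsSchubert-cong {w0 (suc a)}
    (λ x → trans (cong (λ n → evalMono x (stair n)) (length-w0 (suc a))) (sym (ℤₚ.*-identityʳ _)))
    (IsSchubert-descending (w0 (suc a)) (w0-descending (suc a))))

FlagAbove : ℕ → ℕ × ℕ → Set
FlagAbove f r = f ≤ proj₂ r

symmetricRows : ∀ {j f rs} → suc (suc j) ≤ f → All (FlagAbove f) rs → All (SymmetricRow j) rs
symmetricRows j<f = All.map (λ f≤ → inj₂ (ℕₚ.≤-trans j<f f≤))

lift-FlagAbove : ∀ {f rs} → All (FlagAbove f) rs → All (FlagAbove (suc f)) (map lift rs)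
lift-FlagAbove above = map⁺ (All.map s≤s above)

length-w0-++ : ∀ a {D} r → length r ≡ D → length (w0 a ++ r) ≡ a +ℕ D
length-w0-++ a r len = trans (length-++ (w0 a)) (cong₂ _+ℕ_ (length-w0 a) len)

split-power : ∀ u a D e z → pow u (a +ℕ D) * (e * z) ≡ pow u a * e * (pow u D * z)
split-power u a D e z rewrite pow-+ u a D = identity (pow u a) (pow u D) e z
  where
  identity : ∀ p q e z → p * q * (e * z) ≡ p * e * (q * z)
  identity = solve-∀

-- The leading maximum contributes x_0^{a+D}: x_0^a completes the staircase, and x_0^D is the pivot
-- of the new row, hence k = 1. While the maximum moves past w_0(a), the lifted rows have flags at
-- least a + 2 and stay symmetric.
IsSchubert-newMaximum : ∀ a {y D n r rs} → All (_< y) (w0 a ++ r) → length r ≡ D → All (FlagAbove (suc a)) rs →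
  IsSchubert (w0 a ++ r) (λ x → evalMono x (stair a) * flagged D n rs x) →
  IsSchubert (w0 a ++ y ∷ r) (λ x → evalMono x (stair a) * flagged (suc D) (suc n) ((1 , suc a) ∷ map lift rs) x)
IsSchubert-newMaximum a {y} {D} {n} {r} {rs} below len above isS =
  IsSchubert-insert (w0 a) g (w0-descending a) (++⁻ˡ (w0 a) below) (length-w0 a)
    (λ j<a → flagged-isobaric {k = 1} (suc D) (suc n) (symmetricRows (s≤s (ℕₚ.m≤n⇒m≤1+n j<a)) (lift-FlagAbove above)))
    (λ j → flagged-congruent (suc D) (suc n) ((1 , suc j) ∷ map lift rs))
    (IsSchubert-cong {y ∷ w0 a ++ r} start (IsSchubert-∷ below isS))
  where
  g : ℕ → Point → ℤ
  g j = flagged (suc D) (suc n) ((1 , suc j) ∷ map lift rs)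
  start : ∀ x → pow (x 0) (length (w0 a ++ r)) * (evalMono (tail x) (stair a) * flagged D n rs (tail x))
              ≡ evalMono x (stair (suc a)) * g 0 x
  start x rewrite length-w0-++ a r len =
    trans (split-power (x 0) a D (evalMono (tail x) (stair a)) (flagged D n rs (tail x)))
          (cong (pow (x 0) a * evalMono (tail x) (stair a) *_) (flagged-border D 1 n rs (ℕₚ.+-comm D 1) x))

-- The base case for the families with one more letter than rows: `flagged 1 0 []` is the constant
-- 1.
IsSchubert-newMaximum-1 : ∀ a {y} → All (_< y) (w0 a ++ []) → IsSchubert (w0 a ++ y ∷ []) (λ x → evalMono x (stair a) * 1ℤ)
IsSchubert-newMaximum-1 a {y} below =
  IsSchubert-insert (w0 a) (λ _ _ → 1ℤ) (w0-descending a) (++⁻ˡ (w0 a) below) (length-w0 a)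
    (λ _ → IsIsobaric-symmetric {f = λ _ → 1ℤ} (λ _ → refl)) (λ _ _ _ → ≈-reflexive refl)
    (IsSchubert-cong {y ∷ w0 a ++ []} start (IsSchubert-∷ below (IsSchubert-w0 a)))
  where
  start : ∀ x → pow (x 0) (length (w0 a ++ [])) * (evalMono (tail x) (stair a) * 1ℤ) ≡ evalMono x (stair (suc a)) * 1ℤ
  start x rewrite length-w0-++ a [] refl | ℕₚ.+-identityʳ a = sym (ℤₚ.*-assoc (pow (x 0) a) _ 1ℤ)

-- Since y < z, the chain has `z` in front of `y` at its far end. Crossing `y` changes nothing, as
-- the form there is symmetric in x_0 and x_1; afterwards the row (3, 2) goes with `z` and the row
-- (2, 1) with `y`. Moving `z` and then `y` past w_0(a) raises their flags to a + 2 and a + 1.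
IsSchubert-newMaxima : ∀ a {y z D n r rs} → All (_< y) (w0 a ++ r) → y < z → length r ≡ D → All (FlagAbove (suc a)) rs →
  IsSchubert (w0 a ++ r) (λ x → evalMono x (stair a) * flagged D n rs x) →
  IsSchubert (w0 a ++ y ∷ z ∷ r) (λ x → evalMono x (stair a)
    * flagged (suc (suc D)) (suc (suc n)) ((2 , suc a) ∷ (3 , suc (suc a)) ∷ map lift (map lift rs)) x)
IsSchubert-newMaxima a {y} {z} {D} {n} {r} {rs} below y<z len above isS =
  IsSchubert-insert (w0 a) g′ (w0-descending a) (++⁻ˡ (w0 a) below) (length-w0 a)
    (λ j<a → flagged-isobaric {k = 2} (suc (suc D)) (suc (suc n))
      (inj₂ (s≤s (ℕₚ.m≤n⇒m≤1+n j<a)) ∷ symmetricRows (s≤s (ℕₚ.m≤n⇒m≤1+n (ℕₚ.m≤n⇒m≤1+n j<a))) above′))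
    (λ j → flagged-congruent (suc (suc D)) (suc (suc n)) ((2 , suc j) ∷ (3 , suc (suc a)) ∷ rs′))
    (IsSchubert-insert (y ∷ w0 a) g descending (y<z ∷ All.map (λ w<y → ℕₚ.<-trans w<y y<z) (++⁻ˡ (w0 a) below))
      (cong suc (length-w0 a)) isobaric congruent
      (IsSchubert-cong {z ∷ y ∷ w0 a ++ r} start
        (IsSchubert-∷ (y<z ∷ All.map (λ w<y → ℕₚ.<-trans w<y y<z) below) (IsSchubert-∷ below isS))))
  where
  rs′ : List (ℕ × ℕ)
  rs′ = map lift (map lift rs)
  above′ : All (FlagAbove (suc (suc (suc a)))) rs′
  above′ = lift-FlagAbove (lift-FlagAbove above)
  g g′ : ℕ → Point → ℤ
  -- `g 0` and `g 1` coincide: this is the crossing of `z` and `y`, where the form is x_0^D x_1^D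
  -- times a function of the later variables.
  g zero = flagged (suc (suc D)) (suc (suc n)) ((2 , 1) ∷ (3 , 2) ∷ rs′)
  g (suc j) = flagged (suc (suc D)) (suc (suc n)) ((2 , 1) ∷ (3 , suc (suc j)) ∷ rs′)
  g′ j = flagged (suc (suc D)) (suc (suc n)) ((2 , suc j) ∷ (3 , suc (suc a)) ∷ rs′)
  g-0 : ∀ x → g 0 x ≡ pow (x 0) D * (pow (x 1) D * flagged D n rs (tail (tail x)))
  g-0 x = sym (trans (cong (pow (x 0) D *_) (flagged-border D 1 n rs (ℕₚ.+-comm D 1) (tail x)))
                     (flagged-border D 2 (suc n) ((1 , 1) ∷ map lift rs) (ℕₚ.+-comm D 2) x))
  g-0-transpose : ∀ x → g 0 (transpose 0 x) ≡ g 0 x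
  g-0-transpose x = trans (g-0 (transpose 0 x))
    (trans (identity (pow (x 1) D) (pow (x 0) D) (flagged D n rs (tail (tail x)))) (sym (g-0 x)))
    where
    identity : ∀ p q e → p * (q * e) ≡ q * (p * e)
    identity = solve-∀
  isobaric : ∀ {j} → j < suc a → IsIsobaric j (g j) (g (suc j))
  isobaric {zero} _ = IsIsobaric-symmetric {f = g 0} g-0-transpose
  isobaric {suc j} (s≤s j<a) = flagged-isobaric₂ {k = 3} {2 , 1} (suc (suc D)) (suc (suc n)) (inj₁ (s≤s z≤n))
    (symmetricRows (s≤s (s≤s (ℕₚ.m≤n⇒m≤1+n j<a))) above′)
  congruent : ∀ j → Congruent (g j)
  congruent zero = flagged-congruent (suc (suc D)) (suc (suc n)) ((2 , 1) ∷ (3 , 2) ∷ rs′)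
  congruent (suc j) = flagged-congruent (suc (suc D)) (suc (suc n)) ((2 , 1) ∷ (3 , suc (suc j)) ∷ rs′)
  descending : firstAscent (y ∷ w0 a) ≡ nothing
  descending = trans (firstAscent-∷ (++⁻ˡ (w0 a) below)) (cong (Data.Maybe.map suc) (w0-descending a))
  start : ∀ x → pow (x 0) (suc (length (w0 a ++ r)))
                  * (pow (x 1) (length (w0 a ++ r)) * (evalMono (tail (tail x)) (stair a) * flagged D n rs (tail (tail x))))
              ≡ evalMono x (stair (suc (suc a))) * g 0 x
  start x rewrite length-w0-++ a r len =
    trans (cong (pow (x 0) (suc a +ℕ D) *_)
                (split-power (x 1) a D (evalMono (tail (tail x)) (stair a)) (flagged D n rs (tail (tail x)))))
          (trans (split-power (x 0) (suc a) D (pow (x 1) a * evalMono (tail (tail x)) (stair a))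
                   (pow (x 1) D * flagged D n rs (tail (tail x))))
                 (cong (pow (x 0) (suc a) * (pow (x 1) a * evalMono (tail (tail x)) (stair a)) *_) (sym (g-0 x))))

-- The row lists of the two families

double : ℕ → ℕ
double zero = zero
double (suc n) = suc (suc (double n))

weave : {A : Set} → List A → List A → List A
weave (x ∷ xs) (y ∷ ys) = x ∷ y ∷ weave xs ys
weave _ _ = []

map-weave : {A B : Set} (f : A → B) (xs ys : List A) → map f (weave xs ys) ≡ weave (map f xs) (map f ys)
map-weave f [] ys = refl
map-weave f (x ∷ xs) [] = refl
map-weave f (x ∷ xs) (y ∷ ys) = cong (λ l → f x ∷ f y ∷ l) (map-weave f xs ys)

weave-All : {A : Set} {P : A → Set} {xs ys : List A} → All P xs → All P ys → All P (weave xs ys)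
weave-All [] _ = []
weave-All (_ ∷ _) [] = []
weave-All (p ∷ ps) (q ∷ qs) = p ∷ q ∷ weave-All ps qs

-- `row a i` is (1, a + 1) lifted i times; `evenRow a i` and `oddRow a i` are (2, a + 1) and (3, a +
-- 2) lifted 2i times. The form of k exposes its parity.
row evenRow oddRow : ℕ → ℕ → ℕ × ℕ
row a i = suc (double i) , suc (i +ℕ a)
evenRow a i = double (suc (double i)) , suc (double i +ℕ a)
oddRow a i = suc (double (suc (double i))) , suc (suc (double i +ℕ a))

rows pairedRows : ℕ → ℕ → List (ℕ × ℕ)
rows a n = applyUpTo (row a) n
pairedRows a n = weave (applyUpTo (evenRow a) n) (applyUpTo (oddRow a) n)

rows-suc : ∀ a n → (1 , suc a) ∷ map lift (rows a n) ≡ rows a (suc n)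
rows-suc a n = cong ((1 , suc a) ∷_) (map-applyUpTo (row a) lift n)

pairedRows-suc : ∀ a n → (2 , suc a) ∷ (3 , suc (suc a)) ∷ map lift (map lift (pairedRows a n)) ≡ pairedRows a (suc n)
pairedRows-suc a n = cong (λ l → (2 , suc a) ∷ (3 , suc (suc a)) ∷ l) (begin
  map lift (map lift (weave es os))                            ≡⟨ cong (map lift) (map-weave lift es os) ⟩
  map lift (weave (map lift es) (map lift os))                 ≡⟨ map-weave lift (map lift es) (map lift os) ⟩
  weave (map lift (map lift es)) (map lift (map lift os))      ≡⟨ cong₂ weave (lift-lift (evenRow a)) (lift-lift (oddRow a)) ⟩
  weave (applyUpTo (λ i → evenRow a (suc i)) n) (applyUpTo (λ i → oddRow a (suc i)) n) ∎)
  where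
  es os : List (ℕ × ℕ)
  es = applyUpTo (evenRow a) n
  os = applyUpTo (oddRow a) n
  lift-lift : ∀ f → map lift (map lift (applyUpTo f n)) ≡ applyUpTo (λ i → lift (lift (f i))) n
  lift-lift f = trans (cong (map lift) (map-applyUpTo f lift n)) (map-applyUpTo (λ i → lift (f i)) lift n)

rows-FlagAbove : ∀ a n → All (FlagAbove (suc a)) (rows a n)
rows-FlagAbove a n = applyUpTo⁺₂ (row a) n (λ i → s≤s (ℕₚ.m≤n+m a i))

pairedRows-FlagAbove : ∀ a n → All (FlagAbove (suc a)) (pairedRows a n)
pairedRows-FlagAbove a n = weave-All
  (applyUpTo⁺₂ (evenRow a) n (λ i → s≤s (ℕₚ.m≤n+m a (double i))))
  (applyUpTo⁺₂ (oddRow a) n (λ i → s≤s (ℕₚ.m≤n⇒m≤1+n (ℕₚ.m≤n+m a (double i)))))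

w̃0-≤ : ∀ N → All (_≤ N) (w̃0 N)
w̃0-≤ zero = []
w̃0-≤ (suc zero) = ℕₚ.≤-refl ∷ []
w̃0-≤ (suc (suc N)) = ℕₚ.n≤1+n (suc N) ∷ ℕₚ.≤-refl ∷ All.map (λ le → ℕₚ.m≤n⇒m≤1+n (ℕₚ.m≤n⇒m≤1+n le)) (w̃0-≤ N)

length-w̃0 : ∀ N → length (w̃0 N) ≡ N
length-w̃0 zero = refl
length-w̃0 (suc zero) = refl
length-w̃0 (suc (suc N)) = cong (λ n → suc (suc n)) (length-w̃0 N)

shifted : ℕ → Perm → Perm
shifted a = map (λ x → x +ℕ a)

shifted-< : ∀ a {p v} → All (_≤ p) v → All (_< suc p +ℕ a) (w0 a ++ shifted a v)
shifted-< a {p} v≤p = ++⁺ (All.map (λ w≤a → s≤s (ℕₚ.≤-trans w≤a (ℕₚ.m≤n+m a p))) (w0-≤ a))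
                          (map⁺ (All.map (λ v≤p → s≤s (ℕₚ.+-monoˡ-≤ a v≤p)) v≤p))

IsSchubert-w0-step : ∀ a p n →
  IsSchubert (w0 a ++ shifted a (w0 p)) (λ x → evalMono x (stair a) * flagged p n (rows a n) x) →
  IsSchubert (w0 a ++ shifted a (w0 (suc p))) (λ x → evalMono x (stair a) * flagged (suc p) (suc n) (rows a (suc n)) x)
IsSchubert-w0-step a p n isS =
  subst (λ rs → IsSchubert (w0 a ++ shifted a (w0 (suc p))) (λ x → evalMono x (stair a) * flagged (suc p) (suc n) rs x))
        (rows-suc a n)
        (IsSchubert-newMaximum a (shifted-< a (w0-≤ p)) (trans (length-map _ (w0 p)) (length-w0 p)) (rows-FlagAbove a n) isS)

IsSchubert-w̃0-step : ∀ a N n →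
  IsSchubert (w0 a ++ shifted a (w̃0 N)) (λ x → evalMono x (stair a) * flagged N (double n) (pairedRows a n) x) →
  IsSchubert (w0 a ++ shifted a (w̃0 (suc (suc N))))
    (λ x → evalMono x (stair a) * flagged (suc (suc N)) (double (suc n)) (pairedRows a (suc n)) x)
IsSchubert-w̃0-step a N n isS =
  subst (λ rs → IsSchubert (w0 a ++ shifted a (w̃0 (suc (suc N))))
                  (λ x → evalMono x (stair a) * flagged (suc (suc N)) (double (suc n)) rs x))
        (pairedRows-suc a n)
        (IsSchubert-newMaxima a (shifted-< a (w̃0-≤ N)) ℕₚ.≤-refl (trans (length-map _ (w̃0 N)) (length-w̃0 N))
          (pairedRows-FlagAbove a n) isS)

IsSchubert-w0-square : ∀ a p →
  IsSchubert (w0 a ++ shifted a (w0 p)) (λ x → evalMono x (stair a) * flagged p p (rows a p) x)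
IsSchubert-w0-square a zero = IsSchubert-w0 a
IsSchubert-w0-square a (suc p) = IsSchubert-w0-step a p p (IsSchubert-w0-square a p)

IsSchubert-w0-reduced : ∀ a p →
  IsSchubert (w0 a ++ shifted a (w0 (suc p))) (λ x → evalMono x (stair a) * flagged (suc p) p (rows a p) x)
IsSchubert-w0-reduced a zero = IsSchubert-newMaximum-1 a (shifted-< a [])
IsSchubert-w0-reduced a (suc p) = IsSchubert-w0-step a (suc p) p (IsSchubert-w0-reduced a p)

IsSchubert-w̃0-even : ∀ a p →
  IsSchubert (w0 a ++ shifted a (w̃0 (double p))) (λ x → evalMono x (stair a) * flagged (double p) (double p) (pairedRows a p) x)
IsSchubert-w̃0-even a zero = IsSchubert-w0 a
IsSchubert-w̃0-even a (suc p) = IsSchubert-w̃0-step a (double p) p (IsSchubert-w̃0-even a p)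

IsSchubert-w̃0-odd : ∀ a p →
  IsSchubert (w0 a ++ shifted a (w̃0 (suc (double p))))
    (λ x → evalMono x (stair a) * flagged (suc (double p)) (double p) (pairedRows a p) x)
IsSchubert-w̃0-odd a zero = IsSchubert-newMaximum-1 a (shifted-< a [])
IsSchubert-w̃0-odd a (suc p) = IsSchubert-w̃0-step a (suc (double p)) p (IsSchubert-w̃0-odd a p)

schubert-idTimes : ∀ a v {D n rs} → All (FlagAbove (suc a)) rs →
  IsSchubert (w0 a ++ shifted a v) (λ x → evalMono x (stair a) * flagged D n rs x) →
  ∀ x → eval x (schubert (idTimes a v)) ≡ flagged D n rs x
schubert-idTimes a v {D} {n} {rs} above isS =
  IsSchubert-eval {idTimes a v}
    (IsSchubert-idPerm a (flagged-congruent D n rs)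
      (λ j<a → flagged-transpose D n (symmetricRows (ℕₚ.m≤n⇒m≤1+n j<a) above)) isS)

-- Nonnegativity at (1, 1, …)

h-< : ∀ x {k d} f → d < k → h x k f d ≡ 0ℤ
h-< x {suc k} {zero} f _ = h-zero x k f
h-< x {suc k} {suc d} f (s≤s d<k) = trans (h-suc x k f d) (h-< x f d<k)

monomial-> : ∀ {k d} → d < k → monomial k d ≡ 0ℤ
monomial-> = h-< ones 0

monomial-diagonal : ∀ k → monomial k k ≡ 1ℤ
monomial-diagonal zero = refl
monomial-diagonal (suc k) = monomial-diagonal k

range-< : ∀ s n → All (_< s +ℕ n) (range s n)
range-< s zero = []
range-< s (suc n) rewrite ℕₚ.+-suc s n = s≤s (ℕₚ.m≤m+n s n) ∷ range-< (suc s) n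

det-zeroColumn : ∀ {R C : Set} (b : R → C → ℤ) {rs c} → All (λ r → b r c ≡ 0ℤ) rs → ∀ l → det b rs (c ∷ l) ≡ 0ℤ
det-zeroColumn b [] l = refl
det-zeroColumn b {rs = r ∷ rs} {c} (r≡0 ∷ rs≡0) l
  rewrite r≡0
        | contract-0 {P = λ _ → ⊤} (b r) {λ m → det b rs (c ∷ m)} (λ {m} _ → det-zeroColumn b rs≡0 m)
            (All.universal (λ _ → tt) l) = refl

det-equalRows : ∀ {R C : Set} (b : R → C → ℤ) r rs l → det b (r ∷ r ∷ rs) l ≡ 0ℤ
det-equalRows b r rs l = ≡-⇒≡0 (contract-anticommutes (b r) (b r) (det b rs) l)

_≼_ : ℕ × ℕ → ℕ × ℕ → Set
r ≼ s = proj₁ r ≤ proj₁ s × proj₂ r ≤ proj₂ s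

≼-trans : ∀ {r s t} → r ≼ s → s ≼ t → r ≼ t
≼-trans (p , q) (p′ , q′) = ℕₚ.≤-trans p p′ , ℕₚ.≤-trans q q′

-- Expansion of a row by `h-lastVariable` lowers f in one summand and B ∸ k in the other.
measure : ℕ → List (ℕ × ℕ) → ℕ
measure B [] = 0
measure B ((k , f) ∷ rs) = f +ℕ (B ∸ k) +ℕ measure B rs

det₁ : List (ℕ × ℕ) → List ℕ → ℤ
det₁ = det (entry ones)

-- Expands by h-lastVariable the last row of an initial run of equal k with increasing flags, so that k and f stay weakly
-- increasing in both summands. The bound (k , f) is what remains of the first row.
data Expansion (B k f : ℕ) (rs : List (ℕ × ℕ)) : Set where
  vanishing : (∀ {l} → All (_< B) l → det₁ rs l ≡ 0ℤ) → Expansion B k f rs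
  splitting : ∀ rs₁ rs₂ →
    (∀ {r} → r ≼ (k , f) → Linked _≼_ (r ∷ rs₁)) → (∀ {r} → r ≼ (k , f) → Linked _≼_ (r ∷ rs₂)) →
    measure B rs₁ < measure B rs → measure B rs₂ < measure B rs →
    (∀ l → det₁ rs l ≡ det₁ rs₁ l + 1ℤ * det₁ rs₂ l) → Expansion B k f rs

∸-suc : ∀ {k B} → k < B → B ∸ k ≡ suc (B ∸ suc k)
∸-suc {zero} {suc B} _ = refl
∸-suc {suc k} {suc B} (s≤s k<B) = ∸-suc k<B

-- If k ≥ B, the row vanishes on all columns below B. Otherwise k < B makes the drop of B ∸ k
-- genuine, and both summands have smaller measure.
splitHead : ∀ B k f {rs} → (∀ {r} → r ≼ (k , suc f) → Linked _≼_ (r ∷ rs)) →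
  Linked _≼_ ((suc k , suc f) ∷ rs) → Expansion B k f ((k , suc f) ∷ rs)
splitHead B k f {rs} linked linked-suc with k ℕₚ.<? B
... | no k≮B = vanishing λ l<B → contract-vanishing (det₁ rs)
  (All.map (λ d<B → h-< ones (suc f) (ℕₚ.<-≤-trans d<B (ℕₚ.≮⇒≥ k≮B))) l<B)
... | yes k<B = splitting ((k , f) ∷ rs) ((suc k , suc f) ∷ rs)
  (λ r≼ → r≼ ∷ linked (ℕₚ.≤-refl , ℕₚ.n≤1+n f))
  (λ r≼ → ≼-trans r≼ (ℕₚ.n≤1+n k , ℕₚ.n≤1+n f) ∷ linked-suc)
  ℕₚ.≤-refl
  (s≤s (ℕₚ.+-monoˡ-≤ (measure B rs) (ℕₚ.≤-reflexive (trans (sym (ℕₚ.+-suc f _)) (cong (f +ℕ_) (sym (∸-suc k<B)))))))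
  (contract-+*ˡ 1ℤ (det₁ rs) (h-lastVariable ones k f))

expandTail : ∀ {B k₀ f₀ k f k′ f′ rs} → (k₀ , f₀) ≼ (k , f) → (k , f) ≼ (k′ , f′) →
  Expansion B k′ f′ rs → Expansion B k₀ f₀ ((k , f) ∷ rs)
expandTail {k = k} {f} below le (vanishing eq) = vanishing (contract-0 (h ones k f) eq)
expandTail {B} {k = k} {f} below le (splitting rs₁ rs₂ linked₁ linked₂ less₁ less₂ eq) =
  splitting ((k , f) ∷ rs₁) ((k , f) ∷ rs₂)
    (λ r≼ → ≼-trans r≼ below ∷ linked₁ le) (λ r≼ → ≼-trans r≼ below ∷ linked₂ le)
    (ℕₚ.+-monoʳ-< (f +ℕ (B ∸ k)) less₁) (ℕₚ.+-monoʳ-< (f +ℕ (B ∸ k)) less₂)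
    (contract-+*ʳ 1ℤ (h ones k f) eq)

expand : ∀ B k f rs → Linked _≼_ ((k , suc f) ∷ rs) → Expansion B k f ((k , suc f) ∷ rs)
expand B k f [] [-] = splitHead B k f (λ _ → [-]) [-]
expand B k f ((k′ , f′) ∷ rs) ((k≤k′ , f<f′) ∷ linked) with ℕₚ.m≤n⇒m<n∨m≡n k≤k′ | ℕₚ.m≤n⇒m<n∨m≡n f<f′
... | inj₁ k<k′ | _ = splitHead B k f (λ r≼ → ≼-trans r≼ (k≤k′ , f<f′) ∷ linked) ((k<k′ , f<f′) ∷ linked)
... | inj₂ refl | inj₂ refl = vanishing λ {l} _ → det-equalRows (entry ones) (k , suc f) rs l
-- Within a run of equal k the flags increase strictly, so a later row can lose one and still
-- dominate this row.
... | inj₂ refl | inj₁ (s≤s {n = f″} sf≤f″) =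
  expandTail (ℕₚ.≤-refl , ℕₚ.n≤1+n f) (ℕₚ.≤-refl , sf≤f″) (expand B k f″ rs linked)

-- Induction on the fuel and, within it, on the list of rows: a splitting costs fuel, while the
-- removal of a row with flag 0 shortens the list. Such a row has a single 1, in column k: for k < D
-- the row is zero on the range, for k > D column D is zero, and for k = D a smaller determinant
-- remains.
det₁-nonNegative : ∀ fuel {B D n} rs → D +ℕ n ≡ B → measure B rs ≤ fuel → Linked _≼_ rs → 0ℤ ≤ℤ det₁ rs (range D n)
expansion-nonNegative : ∀ fuel {B D n k f rs} → D +ℕ n ≡ B → measure B rs ≤ fuel → Expansion B k f rs → 0ℤ ≤ℤ det₁ rs (range D n)
flagZero-nonNegative : ∀ fuel {B D} n k rs → D +ℕ n ≡ B → measure B rs ≤ fuel → Linked _≼_ rs → All (λ r → k < proj₁ r) rs →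
  0ℤ ≤ℤ det₁ ((k , 0) ∷ rs) (range D n)

det₁-nonNegative fuel {n = zero} [] _ _ _ = +≤+ z≤n
det₁-nonNegative fuel {n = suc n} [] _ _ _ = ℤₚ.≤-refl
det₁-nonNegative fuel {B} {D} {n} ((k , suc f) ∷ rs) D+n bound linked = expansion-nonNegative fuel {D = D} {n} D+n bound (expand B k f rs linked)
det₁-nonNegative fuel {n = n} ((k , zero) ∷ []) D+n bound _ =
  flagZero-nonNegative fuel n k [] D+n (ℕₚ.m+n≤o⇒n≤o _ bound) [] []
det₁-nonNegative fuel {B} {D} {n} ((k , zero) ∷ (k′ , f′) ∷ rs) D+n bound ((k≤k′ , _) ∷ linked) with ℕₚ.m≤n⇒m<n∨m≡n k≤k′ | f′
... | inj₁ k<k′ | _ = flagZero-nonNegative fuel n k ((k′ , _) ∷ rs) D+n (ℕₚ.m+n≤o⇒n≤o (B ∸ k) bound) linked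
  (All.map proj₁ (Linkedₚ.Linked⇒All ≼-trans {suc k , 0} (k<k′ , z≤n) linked))
... | inj₂ refl | zero = ℤₚ.≤-reflexive (sym (det-equalRows (entry ones) (k , 0) rs (range D n)))
... | inj₂ refl | suc f″ = expansion-nonNegative fuel {D = D} {n} D+n bound
  -- Nothing stands before the head row, so (0, 0) serves as its bound.
  (expandTail {k₀ = 0} {0} (z≤n , z≤n) (ℕₚ.≤-refl , z≤n) (expand B k f″ rs linked))

expansion-nonNegative fuel {D = D} {n} D+n bound (vanishing eq) =
  ℤₚ.≤-reflexive (sym (eq (subst (λ b → All (_< b) (range D n)) D+n (range-< D n))))
expansion-nonNegative zero D+n bound (splitting rs₁ rs₂ linked₁ linked₂ less₁ less₂ eq) =
  ⊥-elim (ℕₚ.n≮0 (ℕₚ.<-≤-trans less₁ bound))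
expansion-nonNegative (suc fuel) {D = D} {n} D+n bound (splitting rs₁ rs₂ linked₁ linked₂ less₁ less₂ eq) =
  subst (0ℤ ≤ℤ_) (sym (trans (eq (range D n)) (cong (_+_ (det₁ rs₁ (range D n))) (ℤₚ.*-identityˡ _))))
    -- A phantom row (0, 0) is put in front to obtain linkedness and then dropped.
    (ℤₚ.+-mono-≤ (det₁-nonNegative fuel rs₁ D+n (ℕₚ.≤-pred (ℕₚ.≤-trans less₁ bound)) (Linked.tail (linked₁ {0 , 0} (z≤n , z≤n))))
                 (det₁-nonNegative fuel rs₂ D+n (ℕₚ.≤-pred (ℕₚ.≤-trans less₂ bound)) (Linked.tail (linked₂ {0 , 0} (z≤n , z≤n)))))

flagZero-nonNegative fuel zero k rs _ _ _ _ = ℤₚ.≤-refl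
flagZero-nonNegative fuel {D = D} (suc n) k rs D+n bound linked above with ℕₚ.<-cmp k D
... | tri< k<D _ _ = ℤₚ.≤-reflexive (sym (contract-vanishing (det₁ rs)
  (All.map (λ D≤d → monomial-< (ℕₚ.<-≤-trans k<D D≤d)) (range-≥ D (suc n)))))
... | tri> _ _ D<k = ℤₚ.≤-reflexive (sym (det-zeroColumn (entry ones) {(k , 0) ∷ rs} {D}
  (monomial-> D<k ∷ All.map (λ {r} k<k′ → h-< ones (proj₂ r) (ℕₚ.<-trans D<k k<k′)) above) (range (suc D) n)))
... | tri≈ _ refl _ = subst (0ℤ ≤ℤ_) (sym expanded)
  (det₁-nonNegative fuel rs (trans (sym (ℕₚ.+-suc D n)) D+n) bound linked)
  where
  expanded : det₁ ((D , 0) ∷ rs) (range D (suc n)) ≡ det₁ rs (range (suc D) n)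
  expanded rewrite monomial-diagonal D
                 | contract-vanishing {r = monomial D} (λ l → det₁ rs (D ∷ l)) (All.map monomial-< (range-≥ (suc D) n)) =
    trans (ℤₚ.+-identityʳ _) (ℤₚ.*-identityˡ _)

flagged-nonNegative : ∀ D n {rs} → Linked _≼_ rs → 0ℤ ≤ℤ flagged D n rs ones
flagged-nonNegative D n {rs} = det₁-nonNegative (measure (D +ℕ n) rs) rs refl ℕₚ.≤-refl

rows-linked : ∀ a n → Linked _≼_ (rows a n)
rows-linked a n = Linkedₚ.applyUpTo⁺₂ (row a) n (λ i → s≤s (ℕₚ.m≤n⇒m≤1+n (ℕₚ.n≤1+n _)) , ℕₚ.n≤1+n _)

-- Evaluation at (1, −1, 1, −1, …)

-- Multiplication of a power series by 1 / ((1 − t)(1 + t)) = 1 / (1 − t²).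
geometric-± : ∀ s d → geometric 1ℤ (geometric (- 1ℤ) s) (suc (suc d)) ≡ s (suc (suc d)) + geometric 1ℤ (geometric (- 1ℤ) s) d
geometric-± s d = identity (s (suc (suc d))) (geometric (- 1ℤ) s (suc d)) (geometric 1ℤ (geometric (- 1ℤ) s) d)
  where
  identity : ∀ a p q → (a + - 1ℤ * p) + 1ℤ * (p + 1ℤ * q) ≡ a + q
  identity = solve-∀

geometric-±-one : ∀ s → geometric 1ℤ (geometric (- 1ℤ) s) 1 ≡ s 1
geometric-±-one s = identity (s 1) (s 0)
  where
  identity : ∀ a b → (a + - 1ℤ * b) + 1ℤ * b ≡ a
  identity = solve-∀

h-alt-even : ∀ k n d → h alt (double k) (double n) (double d) ≡ h ones k n d
h-alt-even zero zero zero = refl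
h-alt-even zero zero (suc d) = refl
h-alt-even (suc k) zero zero = refl
h-alt-even (suc k) zero (suc d) = h-alt-even k zero d
h-alt-even k (suc n) zero = h-alt-even k n zero
h-alt-even k (suc n) (suc d) = trans (geometric-± (h alt (double k) (double n)) (double d))
  (cong₂ _+_ (h-alt-even k n (suc d)) (trans (h-alt-even k (suc n) d) (sym (ℤₚ.*-identityˡ _))))

h-alt-odd : ∀ k n d → h alt (double k) (double n) (suc (double d)) ≡ 0ℤ
h-alt-odd zero zero d = refl
h-alt-odd (suc k) zero zero = refl
h-alt-odd (suc k) zero (suc d) = h-alt-odd k zero d
h-alt-odd k (suc n) zero = trans (geometric-±-one (h alt (double k) (double n))) (h-alt-odd k n zero)
h-alt-odd k (suc n) (suc d) = trans (geometric-± (h alt (double k) (double n)) (suc (double d)))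
  (cong₂ _+_ (h-alt-odd k n (suc d)) (h-alt-odd k (suc n) d))

evenRow′ : ℕ → ℕ → ℕ × ℕ
evenRow′ a i = double (suc (double i)) , suc (suc (double i +ℕ a))

-- By `h-lastVariable`, the row (k, f + 1) is the row (k, f) plus x_f times the row (k + 1, f + 1),
-- which already stands below it.
det-raiseFlag : ∀ x k f rs l →
  det (entry x) ((k , f) ∷ (suc k , suc f) ∷ rs) l ≡ det (entry x) ((k , suc f) ∷ (suc k , suc f) ∷ rs) l
det-raiseFlag x k f rs l = sym (begin
  contract (h x k (suc f)) K l
    ≡⟨ contract-+*ˡ (x f) K (h-lastVariable x k f) l ⟩
  contract (h x k f) K l + x f * contract (h x (suc k) (suc f)) K l
    ≡⟨ cong (λ z → contract (h x k f) K l + x f * z) (det-equalRows (entry x) (suc k , suc f) rs l) ⟩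
  contract (h x k f) K l + x f * 0ℤ
    ≡⟨ cong (_+_ (contract (h x k f) K l)) (ℤₚ.*-zeroʳ (x f)) ⟩
  contract (h x k f) K l + 0ℤ
    ≡⟨ ℤₚ.+-identityʳ _ ⟩
  contract (h x k f) K l ∎)
  where
  K : List ℕ → ℤ
  K = det (entry x) ((suc k , suc f) ∷ rs)

det-raiseFlags : ∀ x (k f : ℕ → ℕ) n l →
  det (entry x) (weave (applyUpTo (λ i → k i , f i) n) (applyUpTo (λ i → suc (k i) , suc (f i)) n)) l
    ≡ det (entry x) (weave (applyUpTo (λ i → k i , suc (f i)) n) (applyUpTo (λ i → suc (k i) , suc (f i)) n)) l
det-raiseFlags x k f zero l = refl
det-raiseFlags x k f (suc n) l = trans (det-raiseFlag x (k 0) (f 0)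
    (weave (applyUpTo (λ i → k (suc i) , f (suc i)) n) (applyUpTo (λ i → suc (k (suc i)) , suc (f (suc i))) n)) l)
  (contract-cong (λ _ → refl) (contract-cong (λ _ → refl) (det-raiseFlags x (λ i → k (suc i)) (λ i → f (suc i)) n)) l)

weave-↭ : {A : Set} (xs ys : List A) → length xs ≡ length ys → weave xs ys ↭ xs ++ ys
weave-↭ [] [] _ = ↭-refl
weave-↭ (x ∷ xs) (y ∷ ys) len =
  prep x (↭-trans (prep y (weave-↭ xs ys (ℕₚ.suc-injective len))) (↭-sym (shift y xs ys)))

evens odds : ℕ → ℕ → List ℕ
evens c n = map double (range c n)
odds c n = map (λ d → suc (double d)) (range c n)

length-range : ∀ s n → length (range s n) ≡ n
length-range s zero = refl
length-range s (suc n) = cong suc (length-range (suc s) n)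

range-even : ∀ c n → range (double c) (double n) ≡ weave (evens c n) (odds c n)
range-even c zero = refl
range-even c (suc n) = cong (λ l → double c ∷ suc (double c) ∷ l) (range-even (suc c) n)

range-odd : ∀ c n → range (suc (double c)) (double n) ≡ weave (odds c n) (evens (suc c) n)
range-odd c zero = refl
range-odd c (suc n) = cong (λ l → suc (double c) ∷ double (suc c) ∷ l) (range-odd (suc c) n)

length-map-range : ∀ (f : ℕ → ℕ) s n → length (map f (range s n)) ≡ n
length-map-range f s n = trans (length-map f (range s n)) (length-range s n)

range-even-↭ : ∀ c n → range (double c) (double n) ↭ evens c n ++ odds c n
range-even-↭ c n = ↭-trans (↭-reflexive (range-even c n))
  (weave-↭ _ _ (trans (length-map-range _ c n) (sym (length-map-range _ c n))))

-- The range begins with an odd column, so the even columns start one later in their own numbering;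
-- this shift produces F(m, p + 1).
range-odd-↭ : ∀ c n → range (suc (double c)) (double n) ↭ evens (suc c) n ++ odds c n
range-odd-↭ c n = ↭-trans (↭-reflexive (range-odd c n))
  (↭-trans (weave-↭ _ _ (trans (length-map-range _ c n) (sym (length-map-range _ (suc c) n)))) (++-comm (odds c n) (evens (suc c) n)))

double-+ : ∀ i m → double i +ℕ double m ≡ double (i +ℕ m)
double-+ zero m = refl
double-+ (suc i) m = cong (λ n → suc (suc n)) (double-+ i m)

det-applyUpTo : ∀ {x} {f : ℕ → ℕ × ℕ} {g : ℕ → ℕ} {m} → (∀ i d → entry x (f i) (g d) ≡ entry ones (row m i) d) →
  ∀ c n → det (entry x) (applyUpTo f n) (map g (range c n)) ≡ flagged c n (rows m n) ones
det-applyUpTo {x} {f} {g} {m} eq c n = begin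
  det (entry x) (applyUpTo f n) (map g (range c n))
    ≡⟨ cong (λ rs → det (entry x) rs (map g (range c n))) (sym (map-upTo f n)) ⟩
  det (entry x) (map f (upTo n)) (map g (range c n))
    ≡⟨ det-mapRows (entry x) f (upTo n) (map g (range c n)) ⟩
  det (λ i → entry x (f i)) (upTo n) (map g (range c n))
    ≡⟨ det-mapColumns (λ i → entry x (f i)) g (upTo n) (range c n) ⟩
  det (λ i d → entry x (f i) (g d)) (upTo n) (range c n)
    ≡⟨ det-cong (All.universal eq (upTo n)) (range c n) ⟩
  det (λ i → entry ones (row m i)) (upTo n) (range c n)
    ≡⟨ sym (det-mapRows (entry ones) (row m) (upTo n) (range c n)) ⟩
  det (entry ones) (map (row m) (upTo n)) (range c n)
    ≡⟨ cong (λ rs → det (entry ones) rs (range c n)) (map-upTo (row m) n) ⟩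
  flagged c n (rows m n) ones ∎

evenRow′-double : ∀ m i d → entry alt (evenRow′ (double m) i) d ≡ h alt (double (suc (double i))) (double (suc (i +ℕ m))) d
evenRow′-double m i d = cong (λ n → h alt (double (suc (double i))) (suc (suc n)) d) (double-+ i m)

-- After both flags are made even, the rows with even k vanish on odd columns, so sorting rows and
-- columns by parity gives a block triangular matrix. The sign of the sorting is absorbed by ∣ ∣,
-- and separate starts `c` and `c′` serve both parities of N.
∣pairedRows∣ : ∀ m n {c c′ l} → l ↭ evens c n ++ odds c′ n →
  ∣ det (entry alt) (pairedRows (double m) n) l ∣ ≡ ∣ flagged c n (rows m n) ones * flagged c′ n (rows m n) ones ∣
∣pairedRows∣ m n {c} {c′} {l} perm = begin
  ∣ det (entry alt) (pairedRows (double m) n) l ∣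
    ≡⟨ cong ∣_∣ (det-raiseFlags alt (λ i → double (suc (double i))) (λ i → suc (double i +ℕ double m)) n l) ⟩
  ∣ det (entry alt) (weave es os) l ∣
    ≡⟨ ∣det∣-permute (entry alt) (weave-↭ es os (trans length-es (sym (length-applyUpTo (oddRow (double m)) n)))) perm ⟩
  ∣ det (entry alt) (es ++ os) (evens c n ++ odds c′ n) ∣
    ≡⟨ cong ∣_∣ (det-block (entry alt) es os
         (applyUpTo⁺₂ (evenRow′ (double m)) n (λ i → map⁺ (All.universal (killed i) (range c′ n))))
         (evens c n) (trans (length-map-range double c n) (sym length-es))) ⟩
  ∣ det (entry alt) es (evens c n) * det (entry alt) os (odds c′ n) ∣
    ≡⟨ cong ∣_∣ (cong₂ _*_ (det-applyUpTo {f = evenRow′ (double m)} {double} {m} even-entry c n)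
                          (det-applyUpTo {f = oddRow (double m)} {λ d → suc (double d)} {m} odd-entry c′ n)) ⟩
  ∣ flagged c n (rows m n) ones * flagged c′ n (rows m n) ones ∣ ∎
  where
  es os : List (ℕ × ℕ)
  es = applyUpTo (evenRow′ (double m)) n
  os = applyUpTo (oddRow (double m)) n
  length-es : length es ≡ n
  length-es = length-applyUpTo (evenRow′ (double m)) n
  killed : ∀ i d → entry alt (evenRow′ (double m) i) (suc (double d)) ≡ 0ℤ
  killed i d = trans (evenRow′-double m i (suc (double d))) (h-alt-odd (suc (double i)) (suc (i +ℕ m)) d)
  even-entry : ∀ i d → entry alt (evenRow′ (double m) i) (double d) ≡ entry ones (row m i) d
  even-entry i d = trans (evenRow′-double m i (double d)) (h-alt-even (suc (double i)) (suc (i +ℕ m)) d)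
  odd-entry : ∀ i d → entry alt (oddRow (double m) i) (suc (double d)) ≡ entry ones (row m i) d
  odd-entry i d = trans (h-suc alt (double (suc (double i))) (suc (suc (double i +ℕ double m))) (double d)) (even-entry i d)

F-square : ∀ m p → F m p ≡ flagged p p (rows m p) ones
F-square m p = schubert-idTimes m (w0 p) (rows-FlagAbove m p) (IsSchubert-w0-square m p) ones

-- The chain of insertions starts at w_0(1) instead of w_0(0), which saves one row. This is the
-- shape of the even block when N is odd.
F-reduced : ∀ m p → F m (suc p) ≡ flagged (suc p) p (rows m p) ones
F-reduced m p = schubert-idTimes m (w0 (suc p)) (rows-FlagAbove m p) (IsSchubert-w0-reduced m p) ones

+∣*∣ : ∀ {a b} → 0ℤ ≤ℤ a → 0ℤ ≤ℤ b → + ∣ a * b ∣ ≡ a * b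
+∣*∣ {a} {b} 0≤a 0≤b = begin
  + ∣ a * b ∣            ≡⟨ cong +_ (ℤₚ.abs-* a b) ⟩
  + (∣ a ∣ *ℕ ∣ b ∣)     ≡⟨ ℤₚ.pos-* ∣ a ∣ ∣ b ∣ ⟩
  + ∣ a ∣ * + ∣ b ∣      ≡⟨ cong₂ _*_ (ℤₚ.0≤i⇒+∣i∣≡i 0≤a) (ℤₚ.0≤i⇒+∣i∣≡i 0≤b) ⟩
  a * b                  ∎

F̃-even : ∀ m p → F̃ (double m) (double p) ≡ F m p * F m p
F̃-even m p = begin
  + ∣ eval alt (schubert (idTimes (double m) (w̃0 (double p)))) ∣
    ≡⟨ cong (λ z → + ∣ z ∣) (schubert-idTimes (double m) (w̃0 (double p)) (pairedRows-FlagAbove (double m) p)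
         (IsSchubert-w̃0-even (double m) p) alt) ⟩
  + ∣ flagged (double p) (double p) (pairedRows (double m) p) alt ∣
    ≡⟨ cong +_ (∣pairedRows∣ m p (range-even-↭ p p)) ⟩
  + ∣ flagged p p (rows m p) ones * flagged p p (rows m p) ones ∣
    ≡⟨ +∣*∣ (flagged-nonNegative p p (rows-linked m p)) (flagged-nonNegative p p (rows-linked m p)) ⟩
  flagged p p (rows m p) ones * flagged p p (rows m p) ones
    ≡⟨ sym (cong₂ _*_ (F-square m p) (F-square m p)) ⟩
  F m p * F m p ∎

F̃-odd : ∀ m p → F̃ (double m) (suc (double p)) ≡ F m p * F m (suc p)
F̃-odd m p = begin
  + ∣ eval alt (schubert (idTimes (double m) (w̃0 (suc (double p))))) ∣
    ≡⟨ cong (λ z → + ∣ z ∣) (schubert-idTimes (double m) (w̃0 (suc (double p))) (pairedRows-FlagAbove (double m) p)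
         (IsSchubert-w̃0-odd (double m) p) alt) ⟩
  + ∣ flagged (suc (double p)) (double p) (pairedRows (double m) p) alt ∣
    ≡⟨ cong +_ (∣pairedRows∣ m p (range-odd-↭ p p)) ⟩
  + ∣ flagged (suc p) p (rows m p) ones * flagged p p (rows m p) ones ∣
    ≡⟨ +∣*∣ (flagged-nonNegative (suc p) p (rows-linked m p)) (flagged-nonNegative p p (rows-linked m p)) ⟩
  flagged (suc p) p (rows m p) ones * flagged p p (rows m p) ones
    ≡⟨ ℤₚ.*-comm (flagged (suc p) p (rows m p) ones) _ ⟩
  flagged p p (rows m p) ones * flagged (suc p) p (rows m p) ones
    ≡⟨ sym (cong₂ _*_ (F-square m p) (F-reduced m p)) ⟩
  F m p * F m (suc p) ∎

2*-double : ∀ n → 2 *ℕ n ≡ double n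
2*-double zero = refl
2*-double (suc n) = cong suc (trans (ℕₚ.+-suc n (n +ℕ 0)) (cong suc (2*-double n)))

theorem3p10 : (m p : ℕ) → 1 ≤ m →
    (F̃ (2 *ℕ m) (2 *ℕ p +ℕ 0) ≡ F m p *ℤ F m p)
    × (F̃ (2 *ℕ m) (2 *ℕ p +ℕ 1) ≡ F m p *ℤ F m (suc p))
theorem3p10 m p _ =
  trans (cong₂ F̃ (2*-double m) (trans (ℕₚ.+-identityʳ (2 *ℕ p)) (2*-double p))) (F̃-even m p) ,
  trans (cong₂ F̃ (2*-double m) (trans (ℕₚ.+-comm (2 *ℕ p) 1) (cong suc (2*-double p)))) (F̃-odd m p)
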